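{- For a world $W$ of $\mathrm{LO}^{\mathrm{emb}}$, $\mathrm{Val}_{\mathrm{LO}^{\mathrm{emb}}}(W,\mathcal L^{\Diamond}_{\le}(W))=\mathsf{S5}$ if and only if $W$ is a nonempty dense linear order without endpoints.
   Context: Linear orders are total orders, possibly empty. $\mathrm{LO}^{\mathrm{emb}}$ is the category of linear orders and order-embeddings. $\mathcal L^{\Diamond}_{\le}(W)$ is the modal extension (operators $\Diamond,\Box$) of the language $\{\le\}$ with constants naming elements of $W$ (transported along morphisms). Modal satisfaction: $U\models\Diamond\varphi[\nu]$ iff there is a morphism $f:U\to V$ with $V\models\varphi[f\circ\nu]$; $\Box$ dually. $\mathrm{Val}(W,\Gamma)$ is the set of propositional modal formulas $\psi(p_0,\dots,p_n)$ all of whose substitution instances $\psi(\varphi_0,\dots,\varphi_n)$ with $\varphi_i\in\Gamma$ hold at $W$. $\mathsf{S5}$ is the normal modal logic axiomatized by $\Box p\to p$, $\Box p\to\Box\Box p$ and $\Diamond\Box p\to p$. -}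

module Defs where

open import Level using (Lift)
open import Data.Nat using (ℕ; zero; suc)
open import Data.Fin using (Fin)
open import Data.Vec.Functional using (_∷_)
open import Data.Product using (Σ; _×_; _,_; ∃)
open import Data.Empty using (⊥)
open import Function using (_∘_; id)
open import Relation.Nullary using (¬_)
open import Relation.Binary.PropositionalEquality using (_≡_)
open import Relation.Binary.Structures using (IsTotalOrder)

record LinOrd : Set₁ where
  field
    Carrier      : Set
    _≤_          : Carrier → Carrier → Set
    isTotalOrder : IsTotalOrder _≡_ _≤_

open LinOrd public using (Carrier)

record _↪_ (U V : LinOrd) : Set where
  field
    fun     : Carrier U → Carrier V
    mono    : ∀ {x y} → LinOrd._≤_ U x y → LinOrd._≤_ V (fun x) (fun y)
    reflect : ∀ {x y} → LinOrd._≤_ V (fun x) (fun y) → LinOrd._≤_ U x y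

open _↪_ public using (fun)

-- The modal first-order language L^◇_≤(C) with constants from C
-- (de Bruijn variables; n = number of free variables).
-- Primitives: ⊥, atomic ≤ and =, →, ∀, □.  Other connectives are
-- abbreviations (classical reading).

data Term (C : Set) (n : ℕ) : Set where
  var : Fin n → Term C n
  con : C → Term C n

data Fm (C : Set) : ℕ → Set where
  ⊥'   : ∀ {n} → Fm C n
  _≤'_ : ∀ {n} → Term C n → Term C n → Fm C n
  _≐_  : ∀ {n} → Term C n → Term C n → Fm C n
  _⇒_  : ∀ {n} → Fm C n → Fm C n → Fm C n
  ∀'   : ∀ {n} → Fm C (suc n) → Fm C n
  □'   : ∀ {n} → Fm C n → Fm C n

¬' : ∀ {C n} → Fm C n → Fm C n
¬' φ = φ ⇒ ⊥'

◇' : ∀ {C n} → Fm C n → Fm C n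
◇' φ = ¬' (□' (¬' φ))

eval : ∀ {C n} (U : LinOrd) → (C → Carrier U) → (Fin n → Carrier U) →
       Term C n → Carrier U
eval U κ ρ (var i) = ρ i
eval U κ ρ (con c) = κ c

Sat : ∀ {C n} (U : LinOrd) → (C → Carrier U) → (Fin n → Carrier U) →
      Fm C n → Set₁
Sat U κ ρ ⊥'       = Lift _ ⊥
Sat U κ ρ (s ≤' t) = Lift _ (LinOrd._≤_ U (eval U κ ρ s) (eval U κ ρ t))
Sat U κ ρ (s ≐ t)  = Lift _ (eval U κ ρ s ≡ eval U κ ρ t)
Sat U κ ρ (φ ⇒ ψ)  = Sat U κ ρ φ → Sat U κ ρ ψ
Sat U κ ρ (∀' φ)   = (a : Carrier U) → Sat U κ (a ∷ ρ) φ
Sat U κ ρ (□' φ)   = (V : LinOrd) (f : U ↪ V) → Sat V (fun f ∘ κ) (fun f ∘ ρ) φ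

data PFm : Set where
  pv  : ℕ → PFm
  ⊥ₚ  : PFm
  _⇒ₚ_ : PFm → PFm → PFm
  □ₚ  : PFm → PFm

¬ₚ : PFm → PFm
¬ₚ A = A ⇒ₚ ⊥ₚ

◇ₚ : PFm → PFm
◇ₚ A = ¬ₚ (□ₚ (¬ₚ A))

inst : ∀ {C} → (ℕ → Fm C 0) → PFm → Fm C 0
inst σ (pv i)   = σ i
inst σ ⊥ₚ       = ⊥'
inst σ (A ⇒ₚ B) = inst σ A ⇒ inst σ B
inst σ (□ₚ A)   = □' (inst σ A)

Val : LinOrd → PFm → Set₁
Val W ψ = (σ : ℕ → Fm (Carrier W) 0) → Sat W id (λ ()) (inst σ ψ)

-- S5: smallest normal modal logic containing T, 4, B (◇□p → p).
-- Classical propositional base given by a complete Hilbert system.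

data S5⊢_ : PFm → Set where
  ax1  : ∀ A B → S5⊢ (A ⇒ₚ (B ⇒ₚ A))
  ax2  : ∀ A B D → S5⊢ ((A ⇒ₚ (B ⇒ₚ D)) ⇒ₚ ((A ⇒ₚ B) ⇒ₚ (A ⇒ₚ D)))
  ax3  : ∀ A → S5⊢ (¬ₚ (¬ₚ A) ⇒ₚ A)
  axK  : ∀ A B → S5⊢ (□ₚ (A ⇒ₚ B) ⇒ₚ (□ₚ A ⇒ₚ □ₚ B))
  axT  : ∀ A → S5⊢ (□ₚ A ⇒ₚ A)
  ax4  : ∀ A → S5⊢ (□ₚ A ⇒ₚ □ₚ (□ₚ A))
  axB  : ∀ A → S5⊢ (◇ₚ (□ₚ A) ⇒ₚ A)
  mp   : ∀ {A B} → S5⊢ (A ⇒ₚ B) → S5⊢ A → S5⊢ B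
  nec  : ∀ {A} → S5⊢ A → S5⊢ (□ₚ A)

module _ (W : LinOrd) where
  private
    _<_ : Carrier W → Carrier W → Set
    x < y = LinOrd._≤_ W x y × ¬ (x ≡ y)

  record IsNonemptyDLOWithoutEndpoints : Set where
    field
      nonempty : Carrier W
      dense    : ∀ x y → x < y → ∃ λ z → (x < z) × (z < y)
      noLeast  : ∀ x → ∃ λ y → y < x
      noGreatest : ∀ x → ∃ λ y → x < y

{-# OPTIONS --safe #-}
-- Soundness.  Let W be dense without endpoints, W ↪ V ↪ U, and let φ have its
-- constants in W and hold throughout the extensions of U.  To get V ⊨ φ one builds
-- U ↪ T such that T and V cannot be told apart by φ.  Finitely many points
-- cut V into open intervals, compared by Ehrenfeucht–Fraïssé games.  Since there are
-- finitely many n-round types, an interval (x , y) with enough points contains a < b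
-- such that (x , a) and (x , b) have the same type, so [a , b) may be repeated any
-- finite number of times; as long finite orders are n-equivalent to X ⊗ ℤ between two
-- points of X, it may be repeated along X ⊗ ℤ, which makes room for an arbitrary
-- order X.  Intervals with few points are isomorphic as soon as they are equivalent,
-- so the same stretching answers the extension moves coming from boxes inside φ.
--
-- Completeness.  A finite S5-countermodel Θ₀ , … , Θₖ is simulated over any w ∈ W by
-- counting the iterated immediate successors of w: the count is 0 in W, and every
-- extension can be extended further so as to give it any value.
--
-- Necessity.  If W is empty, has an endpoint or has a gap, then "some point lies there"
-- is a false sentence that some extension makes necessary, refuting ◇□p → p.
module Submission where

open import Defs
open import Level using (Lift; lift; lower)
open import Data.Bool using (Bool; true; false)
import Data.Bool as Bool
open import Data.Bool.Properties using () renaming (<-isStrictTotalOrder to Bool-isStrictTotalOrder)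
open import Data.Empty using (⊥; ⊥-elim)
open import Data.Fin using (Fin; zero; suc; combine; funToFin; finToFun)
import Data.Fin as Fin
import Data.Fin.Properties as Finₚ
open import Data.Integer using (ℤ; 0ℤ)
import Data.Integer as ℤ
import Data.Integer.Properties as ℤₚ
open import Data.List using (List; []; _∷_; _++_; map)
open import Data.List.Membership.Propositional using (_∈_)
open import Data.List.Membership.Propositional.Properties using (∈-map⁺; ∈-map⁻; ∈-++⁺ˡ; ∈-++⁺ʳ)
open import Data.List.Relation.Unary.Any using (here; there)
open import Data.Nat using (ℕ; zero; suc; _+_; _*_; _⊔_; _^_; _≤_; z≤n; s≤s)
import Data.Nat as ℕ
import Data.Nat.Properties as ℕₚ
open import Data.Product using (Σ; ∃; ∃₂; _×_; _,_; proj₁; proj₂; swap)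
import Data.Product as Prod
open import Data.Sum using (_⊎_; inj₁; inj₂)
import Data.Sum as Sum
open import Data.Unit using (⊤)
import Data.Vec.Functional as Vec
open import Function using (_∘_; id)
open import Function.Bundles using (_⇔_; mk⇔; Equivalence)
import Relation.Binary.Construct.Add.Extrema.Strict as Extrema
import Relation.Binary.Construct.Flip.EqAndOrd as Flip
import Relation.Binary.Construct.NonStrictToStrict as ToStrict
import Relation.Binary.Construct.StrictToNonStrict as FromStrict
open import Relation.Binary.Definitions using (Tri; tri<; tri≈; tri>)
open import Relation.Binary.PropositionalEquality using (_≡_; _≢_; refl; sym; trans; cong; subst; subst₂; isEquivalence)
open import Relation.Binary.Structures using (IsStrictTotalOrder; IsTotalOrder)
open import Relation.Binary.Structures.Biased using (isStrictTotalOrderᶜ)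
open import Relation.Nullary using (¬_; Dec; yes; no; contradiction; recompute)
open import Relation.Nullary.Construct.Add.Extrema using (_±; ⊥±; ⊤±; [_]; [_]-injective)

-- Strict total orders, pullbacks and lexicographic products

record Order : Set₁ where
  field
    Pt                 : Set
    _<_                : Pt → Pt → Set
    isStrictTotalOrder : IsStrictTotalOrder _≡_ _<_

  open IsStrictTotalOrder isStrictTotalOrder public
    using (compare; _<?_; _≟_) renaming (trans to <-trans)

  <-irrefl : ∀ {x} → ¬ (x < x)
  <-irrefl = IsStrictTotalOrder.irrefl isStrictTotalOrder refl

  <-asym : ∀ {x y} → x < y → ¬ (y < x)
  <-asym p q = <-irrefl (<-trans p q)

  _≼_ : Pt → Pt → Set
  x ≼ y = x < y ⊎ x ≡ y

  ≼-<-trans : ∀ {x y z} → x ≼ y → y < z → x < z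
  ≼-<-trans (inj₁ p)    q = <-trans p q
  ≼-<-trans (inj₂ refl) q = q

  <-≼-trans : ∀ {x y z} → x < y → y ≼ z → x < z
  <-≼-trans p (inj₁ q)    = <-trans p q
  <-≼-trans p (inj₂ refl) = p

  ≼-trans : ∀ {x y z} → x ≼ y → y ≼ z → x ≼ z
  ≼-trans (inj₁ p)    q = inj₁ (<-≼-trans p q)
  ≼-trans (inj₂ refl) q = q

  ≮⇒≽ : ∀ {x y} → ¬ (x < y) → y ≼ x
  ≮⇒≽ {x} {y} x≮y with compare x y
  ... | tri< x<y _ _ = contradiction x<y x≮y
  ... | tri≈ _ x≡y _ = inj₂ (sym x≡y)
  ... | tri> _ _ y<x = inj₁ y<x

open Order using (Pt)

less : (X : Order) → Pt X → Pt X → Set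
less = Order._<_

infix 4 less
syntax less X x y = x <[ X ] y

Increasing : (X Y : Order) → (Pt X → Pt Y) → Set
Increasing X Y f = ∀ {a b} → a <[ X ] b → f a <[ Y ] f b

pullback : (Y : Order) {A : Set} (f : A → Pt Y) → (∀ {a b} → f a ≡ f b → a ≡ b) → Order
pullback Y {A} f f-inj = record
  { Pt = A
  ; _<_ = λ a b → f a Y.< f b
  ; isStrictTotalOrder = isStrictTotalOrderᶜ record
      { isEquivalence = isEquivalence
      ; trans = Y.<-trans
      ; compare = cmp } }
  where
  module Y = Order Y
  cmp : ∀ a b → Tri (f a Y.< f b) (a ≡ b) (f b Y.< f a)
  cmp a b with Y.compare (f a) (f b)
  ... | tri< p q r = tri< p (q ∘ cong f) r
  ... | tri≈ p q r = tri≈ p (f-inj q) r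
  ... | tri> p q r = tri> p (q ∘ cong f) r

infixr 5 _⊗_

_⊗_ : Order → Order → Order
X ⊗ Y = record
  { Pt = Pt X × Pt Y
  ; _<_ = _<_
  ; isStrictTotalOrder = isStrictTotalOrderᶜ record
      { isEquivalence = isEquivalence
      ; trans = <-trans
      ; compare = cmp } }
  where
  module X = Order X
  module Y = Order Y
  _<_ : Pt X × Pt Y → Pt X × Pt Y → Set
  (a , b) < (a′ , b′) = a X.< a′ ⊎ (a ≡ a′ × b Y.< b′)
  <-trans : ∀ {p q r} → p < q → q < r → p < r
  <-trans (inj₁ p)          (inj₁ q)          = inj₁ (X.<-trans p q)
  <-trans (inj₁ p)          (inj₂ (refl , _)) = inj₁ p
  <-trans (inj₂ (refl , _)) (inj₁ q)          = inj₁ q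
  <-trans (inj₂ (refl , p)) (inj₂ (refl , q)) = inj₂ (refl , Y.<-trans p q)
  cmp : ∀ p q → Tri (p < q) (p ≡ q) (q < p)
  cmp (a , b) (a′ , b′) with X.compare a a′
  ... | tri< p q r = tri< (inj₁ p) (q ∘ cong proj₁) λ { (inj₁ s) → r s ; (inj₂ (s , _)) → q (sym s) }
  ... | tri> p q r = tri> (λ { (inj₁ s) → p s ; (inj₂ (s , _)) → q s }) (q ∘ cong proj₁) (inj₁ r)
  ... | tri≈ p refl r with Y.compare b b′
  ...   | tri< s t u = tri< (inj₂ (refl , s)) (t ∘ cong proj₂) λ { (inj₁ v) → r v ; (inj₂ (_ , v)) → u v }
  ...   | tri≈ s t u = tri≈ (λ { (inj₁ v) → r v ; (inj₂ (_ , v)) → s v }) (cong (a ,_) t)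
                            (λ { (inj₁ v) → r v ; (inj₂ (_ , v)) → u v })
  ...   | tri> s t u = tri> (λ { (inj₁ v) → r v ; (inj₂ (_ , v)) → s v }) (t ∘ cong proj₂) (inj₂ (refl , u))

-- Ehrenfeucht–Fraïssé equivalence of open intervals

-- `EF X Y n x y x′ y′`: the open intervals (x , y) of X and (x′ , y′) of Y are
-- indistinguishable in n rounds.
data EF (X Y : Order) : ℕ → Pt X → Pt X → Pt Y → Pt Y → Set where
  done : ∀ {x y x′ y′} → EF X Y zero x y x′ y′
  play : ∀ {n x y x′ y′} →
    (∀ {a} → x <[ X ] a → a <[ X ] y →
      ∃ λ a′ → x′ <[ Y ] a′ × a′ <[ Y ] y′ × EF X Y n x a x′ a′ × EF X Y n a y a′ y′) →
    (∀ {a′} → x′ <[ Y ] a′ → a′ <[ Y ] y′ →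
      ∃ λ a → x <[ X ] a × a <[ X ] y × EF X Y n x a x′ a′ × EF X Y n a y a′ y′) →
    EF X Y (suc n) x y x′ y′

EF-sym : ∀ {X Y n x y x′ y′} → EF X Y n x y x′ y′ → EF Y X n x′ y′ x y
EF-sym done = done
EF-sym (play forth back) = play
  (λ p q → let a , r , s , e₁ , e₂ = back p q in a , r , s , EF-sym e₁ , EF-sym e₂)
  (λ p q → let a , r , s , e₁ , e₂ = forth p q in a , r , s , EF-sym e₁ , EF-sym e₂)

EF-trans : ∀ {X Y Z n x y x′ y′ x″ y″} →
  EF X Y n x y x′ y′ → EF Y Z n x′ y′ x″ y″ → EF X Z n x y x″ y″
EF-trans done done = done
EF-trans (play f b) (play f′ b′) = play
  (λ p q → let _ , r , s , e₁ , e₂ = f p q ; a , t , u , e₃ , e₄ = f′ r s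
           in a , t , u , EF-trans e₁ e₃ , EF-trans e₂ e₄)
  (λ p q → let _ , r , s , e₁ , e₂ = b′ p q ; a , t , u , e₃ , e₄ = b r s
           in a , t , u , EF-trans e₃ e₁ , EF-trans e₄ e₂)

EF-lower : ∀ {X Y m n x y x′ y′} → m ≤ n → EF X Y n x y x′ y′ → EF X Y m x y x′ y′
EF-lower z≤n e = done
EF-lower (s≤s m≤n) (play f b) = play
  (λ p q → let a , r , s , e₁ , e₂ = f p q in a , r , s , EF-lower m≤n e₁ , EF-lower m≤n e₂)
  (λ p q → let a , r , s , e₁ , e₂ = b p q in a , r , s , EF-lower m≤n e₁ , EF-lower m≤n e₂)

-- The two halves are played independently. A move in one half is answered there; the other half,
-- weakened by one round, is joined on again by induction. The cut points `y` and `y′` answer each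
-- other.
EF-sum : ∀ {X Y n x y z x′ y′ z′} →
  x <[ X ] y → y <[ X ] z → x′ <[ Y ] y′ → y′ <[ Y ] z′ →
  EF X Y n x y x′ y′ → EF X Y n y z y′ z′ → EF X Y n x z x′ z′
EF-sum _ _ _ _ done done = done
EF-sum {X} {Y} {suc n} {x} {y} {z} {x′} {y′} {z′} xy yz xy′ yz′ E₁@(play f₁ b₁) E₂@(play f₂ b₂) =
  play forth back
  where
  module X = Order X
  module Y = Order Y
  forth : ∀ {a} → x X.< a → a X.< z →
    ∃ λ a′ → x′ Y.< a′ × a′ Y.< z′ × EF X Y n x a x′ a′ × EF X Y n a z a′ z′
  forth {a} xa az with X.compare a y
  ... | tri< ay _ _ = let a′ , r , s , e₁ , e₂ = f₁ xa ay in
        a′ , r , Y.<-trans s yz′ , e₁ , EF-sum ay yz s yz′ e₂ (EF-lower (ℕₚ.n≤1+n _) E₂)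
  ... | tri≈ _ refl _ = y′ , xy′ , yz′ , EF-lower (ℕₚ.n≤1+n _) E₁ , EF-lower (ℕₚ.n≤1+n _) E₂
  ... | tri> _ _ ya = let a′ , r , s , e₁ , e₂ = f₂ ya az in
        a′ , Y.<-trans xy′ r , s , EF-sum xy ya xy′ r (EF-lower (ℕₚ.n≤1+n _) E₁) e₁ , e₂
  back : ∀ {a′} → x′ Y.< a′ → a′ Y.< z′ →
    ∃ λ a → x X.< a × a X.< z × EF X Y n x a x′ a′ × EF X Y n a z a′ z′
  back {a′} xa az with Y.compare a′ y′
  ... | tri< ay _ _ = let a , r , s , e₁ , e₂ = b₁ xa ay in
        a , r , X.<-trans s yz , e₁ , EF-sum s yz ay yz′ e₂ (EF-lower (ℕₚ.n≤1+n _) E₂)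
  ... | tri≈ _ refl _ = y , xy , yz , EF-lower (ℕₚ.n≤1+n _) E₁ , EF-lower (ℕₚ.n≤1+n _) E₂
  ... | tri> _ _ ya = let a , r , s , e₁ , e₂ = b₂ ya az in
        a , X.<-trans xy r , s , EF-sum xy r xy′ ya (EF-lower (ℕₚ.n≤1+n _) E₁) e₁ , e₂

-- An isomorphism of open intervals, given as a relation that is total both ways, wins any number of
-- rounds: a matched pair cuts both intervals into halves on which `R` is again an isomorphism.
EF-iso : ∀ {X Y} (R : Pt X → Pt Y → Set) →
  (∀ {a b a′ b′} → R a a′ → R b b′ → a <[ X ] b → a′ <[ Y ] b′) →
  (∀ {a b a′ b′} → R a a′ → R b b′ → a′ <[ Y ] b′ → a <[ X ] b) →
  ∀ {x y x′ y′} →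
  (∀ {a} → x <[ X ] a → a <[ X ] y → ∃ λ a′ → x′ <[ Y ] a′ × a′ <[ Y ] y′ × R a a′) →
  (∀ {a′} → x′ <[ Y ] a′ → a′ <[ Y ] y′ → ∃ λ a → x <[ X ] a × a <[ X ] y × R a a′) →
  ∀ n → EF X Y n x y x′ y′
EF-iso R inc dec forth back zero = done
EF-iso {X} {Y} R inc dec {x} {y} {x′} {y′} forth back (suc n) = play
  (λ xa ay → let a′ , r , s , Raa′ = forth xa ay in a′ , r , s , split xa ay r s Raa′)
  (λ xa ay → let a , r , s , Raa′ = back xa ay in a , r , s , split r s xa ay Raa′)
  where
  module X = Order X
  module Y = Order Y
  split : ∀ {a a′} → x X.< a → a X.< y → x′ Y.< a′ → a′ Y.< y′ → R a a′ →
    EF X Y n x a x′ a′ × EF X Y n a y a′ y′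
  split xa ay xa′ ay′ Raa′ =
    EF-iso R inc dec
      (λ p q → let b , r , _ , Rb = forth p (X.<-trans q ay) in b , r , inc Rb Raa′ q , Rb)
      (λ p q → let b , r , _ , Rb = back p (Y.<-trans q ay′) in b , r , dec Rb Raa′ q , Rb) n ,
    EF-iso R inc dec
      (λ p q → let b , _ , s , Rb = forth (X.<-trans xa p) q in b , inc Raa′ Rb p , s , Rb)
      (λ p q → let b , _ , s , Rb = back (Y.<-trans xa′ p) q in b , dec Raa′ Rb p , s , Rb) n

EF-refl : ∀ {X x y} n → EF X X n x y x y
EF-refl = EF-iso _≡_ (λ { refl refl p → p }) (λ { refl refl p → p })
  (λ p q → _ , p , q , refl) (λ p q → _ , p , q , refl)

ExcludedMiddle : Set₁
ExcludedMiddle = (P : Set) → Dec P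

-- Discrete orders

record Discrete (L : Order) : Set where
  open Order L hiding (Pt)
  field
    next prev : Pt L → Pt L
    <-next    : ∀ p → p < next p
    next-min  : ∀ {p q} → p < q → ¬ (q < next p)
    next-prev : ∀ p → next (prev p) ≡ p

  next^ prev^ : ℕ → Pt L → Pt L
  next^ zero    p = p
  next^ (suc k) p = next (next^ k p)
  prev^ zero    p = p
  -- `prev` is applied innermost here and `next` outermost in `next^`, so that the two cancel by a
  -- plain induction.
  prev^ (suc k) p = prev^ k (prev p)

  next^-prev^ : ∀ k p → next^ k (prev^ k p) ≡ p
  next^-prev^ zero    p = refl
  next^-prev^ (suc k) p = trans (cong next (next^-prev^ k (prev p))) (next-prev p)

  next^-+ : ∀ i j p → next^ (i + j) p ≡ next^ i (next^ j p)
  next^-+ zero    j p = refl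
  next^-+ (suc i) j p = cong next (next^-+ i j p)

  <⇒next≼ : ∀ {p q} → p < q → next p ≼ q
  <⇒next≼ p<q = ≮⇒≽ (next-min p<q)

  next-mono-< : ∀ {p q} → p < q → next p < next q
  next-mono-< p<q = ≼-<-trans (<⇒next≼ p<q) (<-next _)

  next^-mono-< : ∀ k {p q} → p < q → next^ k p < next^ k q
  next^-mono-< zero    p<q = p<q
  next^-mono-< (suc k) p<q = next-mono-< (next^-mono-< k p<q)

  next^-mono-≼ : ∀ k {p q} → p ≼ q → next^ k p ≼ next^ k q
  next^-mono-≼ k (inj₁ p<q)  = inj₁ (next^-mono-< k p<q)
  next^-mono-≼ k (inj₂ refl) = inj₂ refl

  next^-cancel-≼ : ∀ k {p q} → next^ k p ≼ next^ k q → p ≼ q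
  next^-cancel-≼ k r = ≮⇒≽ λ q<p → <-irrefl (≼-<-trans r (next^-mono-< k q<p))

  ≼-next^ : ∀ k p → p ≼ next^ k p
  ≼-next^ zero    p = inj₂ refl
  ≼-next^ (suc k) p = inj₁ (≼-<-trans (≼-next^ k p) (<-next _))

  <-next^ : ∀ k p → p < next^ (suc k) p
  <-next^ k p = ≼-<-trans (≼-next^ k p) (<-next _)

  -- Descends from the top: `next-min` leaves no room between `next^ k p` and its successor. Writing
  -- both counts with `suc` records that each of the two parts is nonempty.
  below-next^ : ∀ k {p a} → p < a → a < next^ k p →
    ∃₂ λ i j → k ≡ suc i + suc j × a ≡ next^ (suc j) p
  below-next^ zero    p<a a<p = contradiction a<p (<-asym p<a)
  below-next^ (suc k) {p} {a} p<a a<n with compare a (next^ k p)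
  ... | tri> _ _ n<a = contradiction a<n (next-min n<a)
  ... | tri< a<n′ _ _ = let i , j , k≡ , a≡ = below-next^ k p<a a<n′ in suc i , j , cong suc k≡ , a≡
  below-next^ (suc zero)    p<a a<n | tri≈ _ refl _ = contradiction p<a <-irrefl
  below-next^ (suc (suc k)) p<a a<n | tri≈ _ a≡n _ = 0 , k , refl , a≡n

-- This is 2 ^ n, the classical threshold: n rounds cannot tell apart two distances in a discrete
-- order that are at least this long.
reach : ℕ → ℕ
reach zero    = 1
reach (suc n) = reach n + reach n

reach-pos : ∀ n → ∃ λ k → reach n ≡ suc k
reach-pos zero    = 0 , refl
reach-pos (suc n) = let k , eq = reach-pos n in _ , cong (_+ reach n) eq

module _ {L : Order} (D : Discrete L) where
  open Order L hiding (Pt)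
  open Discrete D

  EF-next^ : ∀ n k {p r} → EF L L n p (next^ k p) r (next^ k r)
  EF-next^ zero    k = done
  EF-next^ (suc n) k {p} {r} = play forth back
    where
    forth : ∀ {a} → p < a → a < next^ k p → ∃ λ a′ → r < a′ × a′ < next^ k r ×
      EF L L n p a r a′ × EF L L n a (next^ k p) a′ (next^ k r)
    forth p<a a<k with below-next^ k p<a a<k
    ... | i , j , refl , refl
      rewrite next^-+ (suc i) (suc j) p | next^-+ (suc i) (suc j) r =
      next^ (suc j) r , <-next^ j r , <-next^ i _ , EF-next^ n (suc j) , EF-next^ n (suc i)
    back : ∀ {a′} → r < a′ → a′ < next^ k r → ∃ λ a → p < a × a < next^ k p ×
      EF L L n p a r a′ × EF L L n a (next^ k p) a′ (next^ k r)
    back r<a a<k with below-next^ k r<a a<k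
    ... | i , j , refl , refl
      rewrite next^-+ (suc i) (suc j) p | next^-+ (suc i) (suc j) r =
      next^ (suc j) p , <-next^ j p , <-next^ i _ , EF-next^ n (suc j) , EF-next^ n (suc i)

  Far : ℕ → Pt L → Pt L → Set
  Far n p q = next^ (reach n) p ≼ q

  far-< : ∀ n {p q} → Far n p q → p < q
  far-< n {p} far with reach n | reach-pos n
  ... | _ | k , refl = <-≼-trans (<-next^ k p) far

  private
    rest-≼ : ∀ n {i j} → reach n ≡ suc i + suc j →
      ∀ p → next^ (reach n) (next^ (suc j) p) ≼ next^ (reach (suc n)) p
    rest-≼ n {i} {j} eq p = subst (next^ (reach n) (next^ (suc j) p) ≼_)
      (sym (next^-+ (reach n) (reach n) p))
      (next^-mono-≼ (reach n)
        (subst (next^ (suc j) p ≼_) (sym (trans (cong (λ k → next^ k p) eq) (next^-+ (suc i) (suc j) p)))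
          (≼-next^ (suc i) _)))

    -- A move within `reach n` of the left end is copied by counting from `r`, and one within
    -- `reach n` of the right end by counting back from `s`. A move far from both ends is answered
    -- by `next^ (reach n) r`. As `reach (suc n)` is twice `reach n`, the part not copied by
    -- counting is always long enough for `n` rounds.
    respond : ∀ n → (∀ {p q r s} → Far n p q → Far n r s → EF L L n p q r s) →
      ∀ {p q r s} → Far (suc n) p q → Far (suc n) r s → ∀ {a} → p < a → a < q →
      ∃ λ a′ → r < a′ × a′ < s × EF L L n p a r a′ × EF L L n a q a′ s
    respond n ih {p} {q} {r} {s} pq rs {a} p<a a<q with a <? next^ (reach n) p
    ... | yes a<far with below-next^ (reach n) p<a a<far
    ...   | i , j , eq , refl =
      next^ (suc j) r , <-next^ j r , far-< n as , EF-next^ n (suc j) ,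
      ih (≼-trans (rest-≼ n eq p) pq) as
      where
      as = ≼-trans (rest-≼ n eq r) rs
    respond n ih {p} {q} {r} {s} pq rs {a} p<a a<q | no a≮far with q <? next^ (reach n) a
    ... | no q≮far = next^ (reach n) r , far-< n (inj₂ refl) , far-< n rs′ ,
      ih (≮⇒≽ a≮far) (inj₂ refl) , ih (≮⇒≽ q≮far) rs′
      where
      rs′ = subst (_≼ s) (next^-+ (reach n) (reach n) r) rs
    ... | yes q<far with below-next^ (reach n) a<q q<far
    ...   | i , j , eq , refl =
      a′ , far-< n ra′ , subst (a′ <_) s≡ (<-next^ j a′) , ih (≮⇒≽ a≮far) ra′ ,
      subst (EF L L n a (next^ (suc j) a) a′) s≡ (EF-next^ n (suc j))
      where
      a′ = prev^ (suc j) s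
      s≡ : next^ (suc j) a′ ≡ s
      s≡ = next^-prev^ (suc j) s
      ra′ : Far n r a′
      -- Both sides are shifted up by `suc j`, which turns `a′` into `s` and reduces the claim to
      -- the length of (r , s).
      ra′ = next^-cancel-≼ (suc j) (subst₂ _≼_ comm (sym s≡) (≼-trans (rest-≼ n eq r) rs))
        where
        comm : next^ (reach n) (next^ (suc j) r) ≡ next^ (suc j) (next^ (reach n) r)
        comm = trans (sym (next^-+ (reach n) (suc j) r))
          (trans (cong (λ k → next^ k r) (ℕₚ.+-comm (reach n) (suc j))) (next^-+ (suc j) (reach n) r))

  EF-far : ∀ n {p q r s} → Far n p q → Far n r s → EF L L n p q r s
  EF-far zero    _  _  = done
  EF-far (suc n) pq rs = play (respond n (EF-far n) pq rs) λ r<a a<s →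
    let a , p<a , a<q , e₁ , e₂ = respond n (EF-far n) rs pq r<a a<s
    in a , p<a , a<q , EF-sym e₁ , EF-sym e₂

ℤ-order : Order
ℤ-order = record { Pt = ℤ ; _<_ = ℤ._<_ ; isStrictTotalOrder = ℤₚ.<-isStrictTotalOrder }

⊗ℤ-discrete : (X : Order) → Discrete (X ⊗ ℤ-order)
⊗ℤ-discrete X = record
  { next      = λ (x , i) → x , ℤ.suc i
  ; prev      = λ (x , i) → x , ℤ.pred i
  ; <-next    = λ (x , i) → inj₂ (refl , ℤₚ.suc[i]≤j⇒i<j ℤₚ.≤-refl)
  ; next-min  = next-min
  ; next-prev = λ (x , i) → cong (x ,_) (ℤₚ.suc-pred i)
  }
  where
  module X = Order X
  next-min : ∀ {p q} → p <[ X ⊗ ℤ-order ] q → ¬ (q <[ X ⊗ ℤ-order ] (proj₁ p , ℤ.suc (proj₂ p)))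
  next-min (inj₁ p)          (inj₁ q)          = X.<-asym p q
  next-min (inj₁ p)          (inj₂ (refl , q)) = X.<-irrefl p
  next-min (inj₂ (refl , p)) (inj₁ q)          = X.<-irrefl q
  next-min (inj₂ (refl , p)) (inj₂ (_ , q))    = ℤₚ.<⇒≱ q (ℤₚ.i<j⇒suc[i]≤j p)

-- Successors stay in the same copy of ℤ, so points over different elements of `X` are infinitely
-- far apart.
⊗ℤ-far : (X : Order) → ∀ k {x y i j} → x <[ X ] y →
  Discrete.next^ (⊗ℤ-discrete X) k (x , i) <[ X ⊗ ℤ-order ] (y , j)
⊗ℤ-far X k {x} {y} {i} x<y = inj₁ (subst (λ z → z <[ X ] y) (sym (same k)) x<y)
  where
  same : ∀ k → proj₁ (Discrete.next^ (⊗ℤ-discrete X) k (x , i)) ≡ x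
  same zero    = refl
  same (suc k) = same k

-- Finitely many types of intervals

-- A type for `suc n` rounds is the set of pairs of n-round types that arise by splitting the
-- interval at a point. It is coded by the characteristic function of that set.
types : ℕ → ℕ
types zero    = 1
types (suc n) = 2 ^ (types n * types n)

bit : ∀ {P : Set} → Dec P → Fin 2
bit (yes _) = suc zero
bit (no _)  = zero

bit-transfer : ∀ {P Q : Set} (p : Dec P) (q : Dec Q) → bit p ≡ bit q → P → Q
bit-transfer (yes _) (yes q) _  _ = q
bit-transfer (no ¬p) _       _  p = contradiction p ¬p
bit-transfer (yes _) (no _)  ()

module _ (em : ExcludedMiddle) where

  type : ∀ n (X : Order) → Pt X → Pt X → Fin (types n)

  Realised : ∀ n (X : Order) → Pt X → Pt X → Fin (types n * types n) → Set
  Realised n X x y c = ∃ λ a → x <[ X ] a × a <[ X ] y × combine (type n X x a) (type n X a y) ≡ c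

  type zero    X x y = zero
  type (suc n) X x y = funToFin (λ c → bit (em (Realised n X x y c)))

  type-transfer : ∀ n (X Y : Order) {x y x′ y′} → type (suc n) X x y ≡ type (suc n) Y x′ y′ →
    ∀ c → Realised n X x y c → Realised n Y x′ y′ c
  type-transfer n X Y {x} {y} {x′} {y′} eq c = bit-transfer (em _) (em _)
    (trans (sym (Finₚ.finToFun-funToFin (λ c → bit (em (Realised n X x y c))) c))
    (trans (cong (λ f → finToFun f c) eq)
           (Finₚ.finToFun-funToFin (λ c → bit (em (Realised n Y x′ y′ c))) c)))

  -- Equal codes realise the same splittings, so each move has an answer whose two halves carry the
  -- same codes as the halves it has to match.
  type-EF : ∀ n (X Y : Order) {x y x′ y′} → type n X x y ≡ type n Y x′ y′ → EF X Y n x y x′ y′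
  type-EF zero    X Y eq = done
  type-EF (suc n) X Y {x} {y} {x′} {y′} eq = play
    (λ {a} p q →
      let a′ , r , s , c = type-transfer n X Y eq _ (a , p , q , refl)
          e₁ , e₂ = Finₚ.combine-injective (type n Y x′ a′) _ (type n X x a) _ c
      in a′ , r , s , type-EF n X Y (sym e₁) , type-EF n X Y (sym e₂))
    (λ {a} p q →
      let a′ , r , s , c = type-transfer n Y X (sym eq) _ (a , p , q , refl)
          e₁ , e₂ = Finₚ.combine-injective (type n X x a′) _ (type n Y x′ a) _ c
      in a′ , r , s , type-EF n X Y e₁ , type-EF n X Y e₂)

-- Intervals with many points

data Spread (X : Order) : ℕ → Pt X → Pt X → Set where
  none : ∀ {x y} → Spread X zero x y
  more : ∀ {n x y a} → x <[ X ] a → a <[ X ] y → Spread X n a y → Spread X (suc n) x y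

spread-snoc : ∀ {X n x a y} → Spread X n x a → x <[ X ] a → a <[ X ] y → Spread X (suc n) x y
spread-snoc none x<a a<y = more x<a a<y none
spread-snoc {X} (more x<b b<a s) x<a a<y = more x<b (Order.<-trans X b<a a<y) (spread-snoc s b<a a<y)

spread-map : ∀ {X Y n x y} {f : Pt X → Pt Y} → Increasing X Y f → Spread X n x y → Spread Y n (f x) (f y)
spread-map inc none = none
spread-map inc (more x<a a<y s) = more (inc x<a) (inc a<y) (spread-map inc s)

module _ {X : Order} where
  open Order X hiding (Pt)

  point : ∀ {n x y} → Spread X n x y → Fin n → Pt X
  point (more {a = a} _ _ _) zero    = a
  point (more _ _ s)         (suc i) = point s i

  point-> : ∀ {n x y} (s : Spread X n x y) i → x < point s i
  point-> (more x<a _ _) zero    = x<a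
  point-> (more x<a _ s) (suc i) = <-trans x<a (point-> s i)

  point-< : ∀ {n x y} (s : Spread X n x y) i → point s i < y
  point-< (more _ a<y _) zero    = a<y
  point-< (more _ _ s)   (suc i) = point-< s i

  point-mono : ∀ {n x y} (s : Spread X n x y) {i j} → i Fin.< j → point s i < point s j
  point-mono (more _ _ s) {zero}  {suc j} _         = point-> s j
  point-mono (more _ _ s) {suc i} {suc j} (s≤s i<j) = point-mono s i<j

-- Pigeonhole: there is one more point than there are n-round types, so two of the initial intervals
-- ending at these points share a type.
spread-repeats : ExcludedMiddle → ∀ {X : Order} n {x y} → Spread X (suc (types n)) x y →
  ∃₂ λ a b → x <[ X ] a × a <[ X ] b × b <[ X ] y × EF X X n x a x b
spread-repeats em {X} n {x} s =
  let i , j , i<j , eq = Finₚ.pigeonhole ℕₚ.≤-refl (λ i → type em n X x (point s i))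
  in point s i , point s j , point-> s i , point-mono s i<j , point-< s j , type-EF em n X X eq

-- Embeddings between open intervals

-- The map is total but is only meaningful on the open interval (x′ , y′).
record IntervalMap (X′ X : Order) (x′ y′ : Pt X′) (x y : Pt X) : Set where
  field
    to     : Pt X′ → Pt X
    above  : ∀ {a} → x′ <[ X′ ] a → a <[ X′ ] y′ → x <[ X ] to a
    below  : ∀ {a} → x′ <[ X′ ] a → a <[ X′ ] y′ → to a <[ X ] y
    mono   : ∀ {a b} → x′ <[ X′ ] a → a <[ X′ ] b → b <[ X′ ] y′ → to a <[ X ] to b

open IntervalMap

interval-∘ : ∀ {X″ X′ X x″ y″ x′ y′} {g : Pt X′ → Pt X} → Increasing X′ X g →
  IntervalMap X″ X′ x″ y″ x′ y′ → IntervalMap X″ X x″ y″ (g x′) (g y′)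
interval-∘ {g = g} inc e = record
  { to = g ∘ to e
  ; above = λ p q → inc (above e p q)
  ; below = λ p q → inc (below e p q)
  ; mono = λ p q r → inc (mono e p q r) }

module _ {X′ X : Order} {x′ y′ z′ : Pt X′} {x y z : Pt X}
         (x<y : x <[ X ] y) (y<z : y <[ X ] z)
         (e₁ : IntervalMap X′ X x′ y′ x y) (e₂ : IntervalMap X′ X y′ z′ y z) where
  private
    module X = Order X
    module X′ = Order X′

  glue : Pt X′ → Pt X
  glue a with X′.compare a y′
  ... | tri< _ _ _ = to e₁ a
  ... | tri≈ _ _ _ = y
  ... | tri> _ _ _ = to e₂ a

  glue-at : glue y′ ≡ y
  glue-at with X′.compare y′ y′
  ... | tri< p _ _ = contradiction p X′.<-irrefl
  ... | tri≈ _ _ _ = refl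
  ... | tri> _ _ p = contradiction p X′.<-irrefl

  glue-right : ∀ {a} → y′ X′.< a → glue a ≡ to e₂ a
  glue-right {a} y<a with X′.compare a y′
  ... | tri< p _ _ = contradiction p (X′.<-asym y<a)
  ... | tri≈ _ refl _ = contradiction y<a X′.<-irrefl
  ... | tri> _ _ p = refl

  interval-glue : IntervalMap X′ X x′ z′ x z
  interval-glue = record { to = glue ; above = ab ; below = be ; mono = mo }
    where
    ab : ∀ {a} → x′ X′.< a → a X′.< z′ → x X.< glue a
    ab {a} xa az with X′.compare a y′
    ... | tri< p _ _ = above e₁ xa p
    ... | tri≈ _ _ _ = x<y
    ... | tri> _ _ p = X.<-trans x<y (above e₂ p az)
    be : ∀ {a} → x′ X′.< a → a X′.< z′ → glue a X.< z
    be {a} xa az with X′.compare a y′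
    ... | tri< p _ _ = X.<-trans (below e₁ xa p) y<z
    ... | tri≈ _ _ _ = y<z
    ... | tri> _ _ p = below e₂ p az
    mo : ∀ {a b} → x′ X′.< a → a X′.< b → b X′.< z′ → glue a X.< glue b
    mo {a} {b} xa ab bz with X′.compare a y′ | X′.compare b y′
    ... | tri< p _ _    | tri< q _ _    = mono e₁ xa ab q
    ... | tri< p _ _    | tri≈ _ _ _    = below e₁ xa p
    ... | tri< p _ _    | tri> _ _ q    = X.<-trans (below e₁ xa p) (above e₂ q bz)
    ... | tri≈ _ refl _ | tri< q _ _    = contradiction q (X′.<-asym ab)
    ... | tri≈ _ refl _ | tri≈ _ refl _ = contradiction ab X′.<-irrefl
    ... | tri≈ _ refl _ | tri> _ _ q    = above e₂ q bz
    ... | tri> _ _ p    | tri< q _ _    = contradiction (X′.<-trans p (X′.<-trans ab q)) X′.<-irrefl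
    ... | tri> _ _ p    | tri≈ _ refl _ = contradiction p (X′.<-asym ab)
    ... | tri> _ _ p    | tri> _ _ q    = mono e₂ p ab bz

-- If (x , y) is empty then so is (x′ , y′), and any map will do. Otherwise one round splits both at
-- matching points: either both halves embed and the maps are glued, or one half has `n` points, to
-- which the splitting point is added.
spread-or-map : ExcludedMiddle → ∀ {X′ X : Order} n {x y x′ y′} → EF X X′ n x y x′ y′ →
  Spread X n x y ⊎ IntervalMap X′ X x′ y′ x y
spread-or-map em zero done = inj₁ none
spread-or-map em {X′} {X} (suc n) {x} {y} {x′} {y′} (play forth back)
  with em (∃ λ a → x <[ X ] a × a <[ X ] y)
... | no empty = inj₂ record
  { to = λ _ → x
  ; above = λ p q → ⊥-elim (no-point p q)
  ; below = λ p q → ⊥-elim (no-point p q)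
  ; mono = λ p q r → ⊥-elim (no-point p (Order.<-trans X′ q r)) }
  where
  no-point : ∀ {a} → x′ <[ X′ ] a → ¬ (a <[ X′ ] y′)
  no-point p q = let a , r , s , _ = back p q in empty (a , r , s)
... | yes (a , x<a , a<y) with forth x<a a<y
...   | a′ , _ , _ , e₁ , e₂ with spread-or-map em n e₁ | spread-or-map em n e₂
...     | inj₁ s  | _       = inj₁ (spread-snoc s x<a a<y)
...     | inj₂ _  | inj₁ s  = inj₁ (more x<a a<y s)
...     | inj₂ m₁ | inj₂ m₂ = inj₂ (interval-glue x<a a<y m₁ m₂)

-- Stretching an interval

record Bounded : Set₁ where
  field
    order : Order
    lo hi : Pt order
    lo<hi : lo <[ order ] hi

module Stretch (X : Order) (a b : Pt X) (a<b : a <[ X ] b) where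
  private module X = Order X

  -- The segment [a , b) of X is replaced by one copy for each element of L.  Levels
  -- outside [lo , hi] are harmless, since only intervals between embedded
  -- points of X are ever considered.
  record Point (L : Bounded) : Set where
    constructor place
    open Bounded L
    field
      pt    : Pt X
      level : Pt order
      .low  : pt X.< a → level ≡ lo
      .high : ¬ (pt X.< b) → level ≡ hi

  open Point using (pt; level)

  -- The side conditions of a place are irrelevant, so that places with the same point and level are
  -- equal; decidable equality of levels recovers them as usable proofs.
  low : ∀ {L} (e : Point L) → pt e X.< a → level e ≡ Bounded.lo L
  low {L} (place _ l p _) u<a = recompute (Order._≟_ (Bounded.order L) l _) (p u<a)

  high : ∀ {L} (e : Point L) → ¬ (pt e X.< b) → level e ≡ Bounded.hi L
  high {L} (place _ l _ p) u≮b = recompute (Order._≟_ (Bounded.order L) l _) (p u≮b)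

  stretched : Bounded → Order
  stretched L = pullback (Bounded.order L ⊗ X) (λ (e : Point L) → level e , pt e) injective
    where
    injective : ∀ {e d : Point L} → (level e , pt e) ≡ (level d , pt d) → e ≡ d
    injective refl = refl

  module _ (L : Bounded) where
    open Bounded L
    private
      module L = Order order
      module S = Order (stretched L)

    -- The embedded copy of `X` is cut at `a`: what lies below stays at the lowest level and the
    -- rest goes to the highest, so the inserted copies of [a , b) fall into the cut.
    embed : Pt X → Point L
    embed u with u X.<? a
    ... | yes u<a = place u lo (λ _ → refl) (λ u≮b → ⊥-elim (u≮b (X.<-trans u<a a<b)))
    ... | no  u≮a = place u hi (λ u<a → ⊥-elim (u≮a u<a)) (λ _ → refl)

    pt-embed : ∀ u → pt (embed u) ≡ u
    pt-embed u with u X.<? a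
    ... | yes _ = refl
    ... | no  _ = refl

    embed-lo : ∀ {u} → u X.< a → level (embed u) ≡ lo
    embed-lo {u} u<a with u X.<? a
    ... | yes _   = refl
    ... | no  u≮a = contradiction u<a u≮a

    embed-hi : ∀ {u} → ¬ (u X.< a) → level (embed u) ≡ hi
    embed-hi {u} u≮a with u X.<? a
    ... | yes u<a = contradiction u<a u≮a
    ... | no  _   = refl

    embed-mono : Increasing X (stretched L) embed
    embed-mono {u} {v} u<v with u X.<? a | v X.<? a
    ... | yes _   | yes _   = inj₂ (refl , u<v)
    ... | yes _   | no  _   = inj₁ lo<hi
    ... | no  u≮a | yes v<a = contradiction (X.<-trans u<v v<a) u≮a
    ... | no  _   | no  _   = inj₂ (refl , u<v)

    mark : Pt order → Point L
    mark l = place a l (λ a<a → ⊥-elim (X.<-irrefl a<a)) (λ a≮b → ⊥-elim (a≮b a<b))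

    -- Within one level the order is that of `X`. A point between `pt e` and `pt d` may be placed on
    -- that level since it inherits the lower side condition from `e` and the upper one from `d`.
    EF-level : ∀ n {e d : Point L} → level e ≡ level d → EF X (stretched L) n (pt e) (pt d) e d
    EF-level n {e} {d} e≡d = EF-iso (λ u c → u ≡ pt c × level c ≡ level e)
      (λ { (refl , l) (refl , l′) p → inj₂ (trans l (sym l′) , p) })
      (λ { (refl , l) (refl , l′) (inj₁ p) → contradiction (subst₂ L._<_ l l′ p) L.<-irrefl
         ; (refl , l) (refl , l′) (inj₂ (_ , p)) → p })
      (λ {u} p q → place u (level e) (λ u<a → low e (X.<-trans p u<a)) (λ u≮b → trans e≡d (high d (λ d<b → u≮b (X.<-trans q d<b)))) ,
                   inj₂ (refl , p) , inj₂ (e≡d , q) , refl , refl)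
      (λ {c} → back {c}) n
      where
      back : ∀ {c} → e S.< c → c S.< d → ∃ λ u → pt e X.< u × u X.< pt d × u ≡ pt c × level c ≡ level e
      back {c} (inj₁ p)       (inj₁ q)       =
        contradiction (L.<-trans p (subst (level c L.<_) (sym e≡d) q)) L.<-irrefl
      back {c} (inj₁ p)       (inj₂ (q , _)) =
        contradiction (subst (level e L.<_) (trans q (sym e≡d)) p) L.<-irrefl
      back {c} (inj₂ (p , _)) (inj₁ q)       =
        contradiction (subst₂ L._<_ (sym p) (sym e≡d) q) L.<-irrefl
      back {c} (inj₂ (l , p)) (inj₂ (_ , q)) = pt c , p , q , refl , sym l

  -- Corresponding levels admit the same points.
  data _~_ {L M : Bounded} : Pt (Bounded.order L) → Pt (Bounded.order M) → Set where
    bottom : Bounded.lo L ~ Bounded.lo M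
    top    : Bounded.hi L ~ Bounded.hi M
    middle : ∀ {l m} → Bounded.lo L <[ Bounded.order L ] l → l <[ Bounded.order L ] Bounded.hi L →
      Bounded.lo M <[ Bounded.order M ] m → m <[ Bounded.order M ] Bounded.hi M → l ~ m

  Corr : (L M : Bounded) → Pt (Bounded.order L) → Pt (Bounded.order M) → Set
  Corr L M = _~_ {L} {M}

  ~-sym : ∀ {L M l m} → Corr L M l m → Corr M L m l
  ~-sym bottom = bottom
  ~-sym top = top
  ~-sym (middle p q r s) = middle r s p q

  module _ {L M : Bounded} where
    private
      module BL = Bounded L
      module BM = Bounded M
      module L = Order BL.order
      module M = Order BM.order
      module T = Order (stretched M)

    ~-low : ∀ {l m} → Corr L M l m → l ≡ BL.lo → m ≡ BM.lo
    ~-low bottom _ = refl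
    ~-low top eq = contradiction (subst (BL.lo L.<_) eq BL.lo<hi) L.<-irrefl
    ~-low (middle p _ _ _) refl = contradiction p L.<-irrefl

    ~-high : ∀ {l m} → Corr L M l m → l ≡ BL.hi → m ≡ BM.hi
    ~-high top _ = refl
    ~-high bottom eq = contradiction (subst (L._< BL.hi) eq BL.lo<hi) L.<-irrefl
    ~-high (middle _ p _ _) refl = contradiction p L.<-irrefl

    ~-above : ∀ {l m} → Corr L M l m → (∀ {i} → l L.< i → BL.lo L.< i) × (∀ {i} → m M.< i → BM.lo M.< i)
    ~-above bottom = id , id
    ~-above top = L.<-trans BL.lo<hi , M.<-trans BM.lo<hi
    ~-above (middle p _ q _) = L.<-trans p , M.<-trans q

    ~-below : ∀ {l m} → Corr L M l m → (∀ {i} → i L.< l → i L.< BL.hi) × (∀ {i} → i M.< m → i M.< BM.hi)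
    ~-below bottom = (λ p → L.<-trans p BL.lo<hi) , (λ p → M.<-trans p BM.lo<hi)
    ~-below top = id , id
    ~-below (middle _ p _ q) = (λ r → L.<-trans r p) , (λ r → M.<-trans r q)

    move : (e : Point L) {m : Pt BM.order} → Corr L M (level e) m → Point M
    move e {m} c = record { pt = pt e ; level = m ; low = λ p → ~-low c (low e p) ; high = λ p → ~-high c (high e p) }

    EF-same : ∀ n {e d : Point L} {e′ d′ : Point M} → pt e ≡ pt e′ → pt d ≡ pt d′ →
      level e ≡ level d → level e′ ≡ level d′ → EF (stretched L) (stretched M) n e d e′ d′
    EF-same n refl refl p q = EF-trans (EF-sym (EF-level L n p)) (EF-level M n q)

    Response : ℕ → (e d : Point L) (e′ d′ : Point M) → Point L → Set
    Response n e d e′ d′ c = ∃ λ c′ → e′ T.< c′ × c′ T.< d′ ×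
      EF (stretched L) (stretched M) n e c e′ c′ × EF (stretched L) (stretched M) n c d c′ d′

  -- A place strictly between the two end levels keeps its point and moves to the level that answers
  -- its own in the game on levels. A place on the level of `e` or `d` moves to the corresponding
  -- end level, and the level game only loses a round.
  respond : ∀ {L M} n →
    (∀ {e d : Point L} {e′ d′ : Point M} → pt e ≡ pt e′ → pt d ≡ pt d′ →
      Corr L M (level e) (level e′) → Corr L M (level d) (level d′) →
      level e <[ Bounded.order L ] level d → level e′ <[ Bounded.order M ] level d′ →
      EF (Bounded.order L) (Bounded.order M) n (level e) (level d) (level e′) (level d′) →
      EF (stretched L) (stretched M) n e d e′ d′) →
    ∀ {e d : Point L} {e′ d′ : Point M} → pt e ≡ pt e′ → pt d ≡ pt d′ →
    Corr L M (level e) (level e′) → Corr L M (level d) (level d′) →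
    level e <[ Bounded.order L ] level d → level e′ <[ Bounded.order M ] level d′ →
    EF (Bounded.order L) (Bounded.order M) (suc n) (level e) (level d) (level e′) (level d′) →
    ∀ {c} → e <[ stretched L ] c → c <[ stretched L ] d → Response {L} {M} n e d e′ d′ c
  respond {L} {M} n ih refl refl ce cd ed ed′ (play forth _) {c} (inj₁ p) (inj₁ q) =
    let i , r , s , e₁ , e₂ = forth p q
        cc = middle (proj₁ (~-above ce) p) (proj₁ (~-below cd) q) (proj₂ (~-above ce) r) (proj₂ (~-below cd) s)
    in move c cc , inj₁ r , inj₁ s , ih refl refl ce cc p r e₁ , ih refl refl cc cd q s e₂
  respond n ih {e} refl refl ce cd ed ed′ E {c@(place _ _ _ _)} (inj₂ (refl , p)) (inj₁ q) =
    move c ce , inj₂ (refl , p) , inj₁ ed′ , EF-same n refl refl refl refl ,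
    ih refl refl ce cd q ed′ (EF-lower (ℕₚ.n≤1+n _) E)
  respond n ih refl refl ce cd ed ed′ E {c@(place _ _ _ _)} (inj₁ p) (inj₂ (refl , q)) =
    move c cd , inj₁ ed′ , inj₂ (refl , q) , ih refl refl ce cd p ed′ (EF-lower (ℕₚ.n≤1+n _) E) ,
    EF-same n refl refl refl refl
  respond {L} n ih refl refl ce cd ed ed′ E (inj₂ (p , _)) (inj₂ (q , _)) =
    contradiction (subst (λ l → l <[ Bounded.order L ] _) (trans p q) ed) (Order.<-irrefl (Bounded.order L))

  EF-stretched : ∀ {L M} n {e d : Point L} {e′ d′ : Point M} → pt e ≡ pt e′ → pt d ≡ pt d′ →
    Corr L M (level e) (level e′) → Corr L M (level d) (level d′) →
    level e <[ Bounded.order L ] level d → level e′ <[ Bounded.order M ] level d′ →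
    EF (Bounded.order L) (Bounded.order M) n (level e) (level d) (level e′) (level d′) →
    EF (stretched L) (stretched M) n e d e′ d′
  EF-stretched zero _ _ _ _ _ _ _ = done
  EF-stretched (suc n) p q ce cd ed ed′ E = play
    (respond n (EF-stretched n) p q ce cd ed ed′ E)
    (λ r s → let c , t , u , e₁ , e₂ = respond n (EF-stretched n) (sym p) (sym q) (~-sym ce) (~-sym cd) ed′ ed (EF-sym E) r s
             in c , t , u , EF-sym e₁ , EF-sym e₂)

  module _ {L : Order} (D : Discrete L) (lo : Pt L) where
    open Discrete D
    private module L = Order L

    copies : ℕ → Bounded
    copies k = record { order = L ; lo = lo ; hi = next^ (suc k) lo ; lo<hi = <-next^ k lo }

    module _ (k : ℕ) {x y : Pt X} (x<a : x X.< a) (b<y : b X.< y) where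
      private
        S = stretched (copies k)
        module S = Order S
        c : ℕ → Point (copies k)
        c i = mark (copies k) (next^ i lo)
        x* = embed (copies k) x
        y* = embed (copies k) y

      embed<mark : ∀ i → x* S.< c i
      embed<mark i with Order.compare L (level x*) (next^ i lo)
      ... | tri< p _ _ = inj₁ p
      ... | tri≈ _ p _ = inj₂ (p , subst (X._< a) (sym (pt-embed (copies k) x)) x<a)
      ... | tri> _ _ p = contradiction
        (L.≼-<-trans (≼-next^ i lo) (subst (_ L.<_) (embed-lo (copies k) x<a) p)) L.<-irrefl

      -- Below the top level only points before `b` occur, and above the bottom level none before
      -- `a`. So exactly one copy of (a , b) lies between consecutive marks.
      EF-segment : ∀ n {i} → next^ i lo L.< next^ (suc k) lo → EF X S n a b (c i) (c (suc i))
      EF-segment n {i} i<k = EF-iso (λ u d → u ≡ pt d × level d ≡ next^ i lo)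
        (λ { (refl , l) (refl , l′) p → inj₂ (trans l (sym l′) , p) })
        (λ { (refl , l) (refl , l′) (inj₁ p) → contradiction (subst₂ L._<_ l l′ p) L.<-irrefl
           ; (refl , l) (refl , l′) (inj₂ (_ , p)) → p })
        (λ {u} p q → place u (next^ i lo) (λ u<a → ⊥-elim (X.<-asym p u<a)) (λ u≮b → ⊥-elim (u≮b q)) ,
                     inj₂ (refl , p) , inj₁ (<-next _) , refl , refl)
        (λ {d} → back {d}) n
        where
        back : ∀ {d} → c i S.< d → d S.< c (suc i) → ∃ λ u → a X.< u × u X.< b × u ≡ pt d × level d ≡ next^ i lo
        back (inj₁ p) (inj₁ q) = contradiction q (next-min p)
        back {d} _ (inj₂ (p , q)) = contradiction
          (subst (lo L.<_) (trans (sym p) (low d q)) (<-next^ i lo)) L.<-irrefl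
        back {d} (inj₂ (l , p)) (inj₁ _) with pt d X.<? b
        ... | yes d<b = _ , p , d<b , refl , sym l
        ... | no  d≮b = contradiction
          (subst (L._< next^ (suc k) lo) (trans l (high d d≮b)) i<k) L.<-irrefl

      -- (x , a) and (x , b) being equivalent, appending a copy of [a , b) does not change the type.
      EF-copies : ∀ n → EF X X n x a x b → EF X S n x y x* y*
      EF-copies n E = EF-sum x<a (X.<-trans a<b b<y) (embed<mark (suc k)) top<y
        (upTo (suc k) ℕₚ.≤-refl) (subst (λ v → EF X S n a v _ y*) (pt-embed (copies k) y)
          (EF-level (copies k) n {c (suc k)} {y*} (sym level-y)))
        where
        level-y : level y* ≡ next^ (suc k) lo
        level-y = embed-hi (copies k) (X.<-asym (X.<-trans a<b b<y))
        top<y : c (suc k) S.< y*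
        top<y = inj₂ (sym level-y , subst (a X.<_) (sym (pt-embed (copies k) y)) (X.<-trans a<b b<y))
        upTo : ∀ i → i ≤ suc k → EF X S n x a x* (c i)
        upTo zero    _   = subst (λ v → EF X S n v a x* (c 0)) (pt-embed (copies k) x)
          (EF-level (copies k) n {x*} {c 0} (embed-lo (copies k) x<a))
        upTo (suc i) i<k = EF-trans E (EF-sum x<a a<b (embed<mark i) (inj₁ (<-next _))
          (upTo i (ℕₚ.<⇒≤ i<k)) (EF-segment n {i} (next^-mono i<k)))
          where
          next^-mono : ∀ {i k} → suc i ≤ suc k → next^ i lo L.< next^ (suc k) lo
          next^-mono {i} {k} (s≤s i≤k) with ℕₚ.m≤n⇒∃[o]m+o≡n i≤k
          ... | m , refl = subst (next^ i lo L.<_)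
            (trans (sym (next^-+ (suc m) i lo)) (cong (λ j → next^ (suc j) lo) (ℕₚ.+-comm m i))) (<-next^ m _)

-- `inner`, `left` and `right` keep the n-round type of (x , y) and of every interval on either side
-- of it, so that stretchings of adjacent intervals can be composed.
record Stretching (X X′ : Order) (n : ℕ) (x y : Pt X) (x′ y′ : Pt X′) : Set₁ where
  field
    target : Order
    into   : Pt X → Pt target
    inc    : Increasing X target into
    left   : ∀ {p q} → p <[ X ] q → ¬ (x <[ X ] q) → EF X target n p q (into p) (into q)
    right  : ∀ {p q} → p <[ X ] q → ¬ (p <[ X ] y) → EF X target n p q (into p) (into q)
    inner  : EF X target n x y (into x) (into y)
    room   : IntervalMap X′ target x′ y′ (into x) (into y)

-- Repeating [a , b) finitely often along `small` keeps the type. The level orders of `small` and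
-- `big` are both long, hence n-equivalent, so `big` keeps it as well. There, `u` is sent to the
-- left end of the copy at level `(u , 0ℤ)`.
stretch : ExcludedMiddle → ∀ {X X′ : Order} n {x y x′ y′} → x′ <[ X′ ] y′ →
  Spread X (suc (types n)) x y → Stretching X X′ n x y x′ y′
stretch em {X} {X′} n {x} {y} {x′} {y′} x′<y′ spread with spread-repeats em n spread
... | a , b , x<a , a<b , b<y , E = record
  { target = stretched big
  ; into = embed big
  ; inc = embed-mono big
  ; left = λ {p} {q} p<q x≮q →
      let q<a = X.≼-<-trans (X.≮⇒≽ x≮q) x<a in
      level-EF (trans (embed-lo big (X.<-trans p<q q<a)) (sym (embed-lo big q<a)))
  ; right = λ {p} {q} p<q p≮y →
      let a<p = X.<-≼-trans (X.<-trans a<b b<y) (X.≮⇒≽ p≮y) in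
      level-EF (trans (embed-hi big (X.<-asym a<p)) (sym (embed-hi big (X.<-asym (X.<-trans a<p p<q)))))
  ; inner = EF-trans (EF-copies D lo k x<a b<y n E)
      (EF-stretched n (trans (pt-embed small x) (sym (pt-embed big x))) (trans (pt-embed small y) (sym (pt-embed big y)))
        (subst₂ (Corr small big) (sym (embed-lo small x<a)) (sym (embed-lo big x<a)) bottom)
        (subst₂ (Corr small big) (sym (embed-hi small a≮y)) (sym (embed-hi big a≮y)) top)
        (subst₂ L._<_ (sym (embed-lo small x<a)) (sym (embed-hi small a≮y)) (Bounded.lo<hi small))
        (subst₂ L._<_ (sym (embed-lo big x<a)) (sym (embed-hi big a≮y)) (Bounded.lo<hi big))
        levels)
  ; room = record
      { to = λ u → mark big (u , 0ℤ)
      ; above = λ p _ → inj₁ (subst (L._< _) (sym (embed-lo big x<a)) (inj₁ p))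
      ; below = λ _ q → inj₁ (subst (_ L.<_) (sym (embed-hi big a≮y)) (inj₁ q))
      ; mono = λ _ q _ → inj₁ (inj₁ q) }
  }
  where
  open Stretch X a b a<b
  module X = Order X
  D = ⊗ℤ-discrete X′
  module L = Order (X′ ⊗ ℤ-order)
  lo = x′ , 0ℤ
  -- With `suc k ≡ reach n`, the top level of `small` is just far enough from `lo` for `EF-far`.
  k = proj₁ (reach-pos n)
  small = copies D lo k
  big : Bounded
  big = record { order = X′ ⊗ ℤ-order ; lo = lo ; hi = y′ , 0ℤ ; lo<hi = inj₁ x′<y′ }
  a≮y : ¬ (y X.< a)
  a≮y = X.<-asym (X.<-trans a<b b<y)
  level-EF : ∀ {p q} → Point.level (embed big p) ≡ Point.level (embed big q) →
    EF X (stretched big) n p q (embed big p) (embed big q)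
  level-EF {p} {q} eq = subst₂ (λ u v → EF X (stretched big) n u v (embed big p) (embed big q))
    (pt-embed big p) (pt-embed big q) (EF-level big n {embed big p} {embed big q} eq)
  levels : EF (X′ ⊗ ℤ-order) (X′ ⊗ ℤ-order) n (Point.level (embed small x)) (Point.level (embed small y))
                    (Point.level (embed big x)) (Point.level (embed big y))
  levels rewrite embed-lo small x<a | embed-lo big x<a | embed-hi small a≮y | embed-hi big a≮y =
    EF-far D n (inj₂ (cong (λ j → Discrete.next^ D j lo) (proj₂ (reach-pos n)))) (inj₁ (⊗ℤ-far X′ (reach n) x′<y′))

-- Chains of corresponding points

IntervalRel : Order → Order → Set₁
IntervalRel X X′ = Pt X → Pt X → Pt X′ → Pt X′ → Set

-- Finitely many points strictly between x and z, increasingly listed with their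
-- partners between x′ and z′; consecutive intervals are related by P.
data Chain (X X′ : Order) (P : IntervalRel X X′) :
           Pt X → Pt X′ → List (Pt X × Pt X′) → Pt X → Pt X′ → Set where
  last : ∀ {x x′ z z′} → x <[ X ] z → x′ <[ X′ ] z′ → P x z x′ z′ → Chain X X′ P x x′ [] z z′
  link : ∀ {x x′ y y′ ps z z′} → x <[ X ] y → x′ <[ X′ ] y′ → P x y x′ y′ →
    Chain X X′ P y y′ ps z z′ → Chain X X′ P x x′ ((y , y′) ∷ ps) z z′

chain-map : ∀ {X X′ Y Y′} {P : IntervalRel X X′} {Q : IntervalRel Y Y′}
  {f : Pt X → Pt Y} {f′ : Pt X′ → Pt Y′} → Increasing X Y f → Increasing X′ Y′ f′ →
  (∀ {x y x′ y′} → x <[ X ] y → P x y x′ y′ → Q (f x) (f y) (f′ x′) (f′ y′)) →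
  ∀ {x x′ ps z z′} → Chain X X′ P x x′ ps z z′ →
  Chain Y Y′ Q (f x) (f′ x′) (map (Prod.map f f′) ps) (f z) (f′ z′)
chain-map inc inc′ h (last p p′ r)   = last (inc p) (inc′ p′) (h p r)
chain-map inc inc′ h (link p p′ r c) = link (inc p) (inc′ p′) (h p r) (chain-map inc inc′ h c)

chain-relax : ∀ {X X′} {P Q : IntervalRel X X′} → (∀ {x y x′ y′} → P x y x′ y′ → Q x y x′ y′) →
  ∀ {x x′ ps z z′} → Chain X X′ P x x′ ps z z′ → Chain X X′ Q x x′ ps z z′
chain-relax h (last p p′ r)   = last p p′ (h r)
chain-relax h (link p p′ r c) = link p p′ (h r) (chain-relax h c)

chain-swap : ∀ {X X′} {P : IntervalRel X X′} {Q : IntervalRel X′ X} →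
  (∀ {x y x′ y′} → P x y x′ y′ → Q x′ y′ x y) →
  ∀ {x x′ ps z z′} → Chain X X′ P x x′ ps z z′ → Chain X′ X Q x′ x (map swap ps) z′ z
chain-swap h (last p p′ r)   = last p′ p (h r)
chain-swap h (link p p′ r c) = link p′ p (h r) (chain-swap h c)

module _ {X X′ : Order} where
  private
    module X = Order X
    module X′ = Order X′

  chain-< : ∀ {P x x′ ps z z′} → Chain X X′ P x x′ ps z z′ → x X.< z × x′ X′.< z′
  chain-< (last p p′ _)   = p , p′
  chain-< (link p p′ _ c) = let q , q′ = chain-< c in X.<-trans p q , X′.<-trans p′ q′

  member-> : ∀ {P x x′ ps z z′ q q′} → Chain X X′ P x x′ ps z z′ → (q , q′) ∈ ps → x X.< q × x′ X′.< q′
  member-> (link p p′ _ c) (here refl) = p , p′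
  member-> (link p p′ _ c) (there m)   = let q , q′ = member-> c m in X.<-trans p q , X′.<-trans p′ q′

  data SameOrder (p q : Pt X) (p′ q′ : Pt X′) : Set where
    before : p X.< q → p′ X′.< q′ → SameOrder p q p′ q′
    same : p ≡ q → p′ ≡ q′ → SameOrder p q p′ q′
    after : q X.< p → q′ X′.< p′ → SameOrder p q p′ q′

  members-compare : ∀ {P x x′ ps z z′ p p′ q q′} → Chain X X′ P x x′ ps z z′ →
    (p , p′) ∈ ps → (q , q′) ∈ ps → SameOrder p q p′ q′
  members-compare (link _ _ _ c) (here refl) (here refl) = same refl refl
  members-compare (link _ _ _ c) (here refl) (there n)   = let r , r′ = member-> c n in before r r′
  members-compare (link _ _ _ c) (there m)   (here refl) = let r , r′ = member-> c m in after r r′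
  members-compare (link _ _ _ c) (there m)   (there n)   = members-compare c m n

  Splits : IntervalRel X X′ → IntervalRel X X′ → Set
  Splits P Q = ∀ {x y x′ y′ a′} → P x y x′ y′ → x′ X′.< a′ → a′ X′.< y′ →
    ∃ λ a → x X.< a × a X.< y × Q x a x′ a′ × Q a y a′ y′

  record Refinement (Q : IntervalRel X X′) (x : Pt X) (x′ : Pt X′) (ps : List (Pt X × Pt X′))
                    (z : Pt X) (z′ : Pt X′) (a′ : Pt X′) : Set where
    field
      {partner} : Pt X
      {points}  : List (Pt X × Pt X′)
      above     : x X.< partner
      below     : partner X.< z
      chain     : Chain X X′ Q x x′ points z z′
      member    : (partner , a′) ∈ points
      keeps     : ∀ {p} → p ∈ ps → p ∈ points

  -- Only the interval containing `a′` is split; the others are weakened from `P` to `Q`. If `a′` is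
  -- already listed, its existing partner is used.
  refine : ∀ {P Q} → (∀ {x y x′ y′} → P x y x′ y′ → Q x y x′ y′) → Splits P Q →
    ∀ {x x′ ps z z′ a′} → Chain X X′ P x x′ ps z z′ → x′ X′.< a′ → a′ X′.< z′ → Refinement Q x x′ ps z z′ a′
  refine relax split (last _ _ r) xa az =
    let a , p , q , r₁ , r₂ = split r xa az in record
      { above = p ; below = q ; chain = link p xa r₁ (last q az r₂) ; member = here refl ; keeps = λ () }
  refine relax split {a′ = a′} (link {y′ = y′} xy xy′ r c) xa az with X′.compare a′ y′
  ... | tri< ay _ _ =
    let a , p , q , r₁ , r₂ = split r xa ay in record
      { above = p ; below = X.<-trans q (proj₁ (chain-< c))
      ; chain = link p xa r₁ (link q ay r₂ (chain-relax relax c)) ; member = here refl ; keeps = there }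
  ... | tri≈ _ refl _ = record
      { above = xy ; below = proj₁ (chain-< c)
      ; chain = link xy xy′ (relax r) (chain-relax relax c) ; member = here refl ; keeps = id }
  ... | tri> _ _ ya =
    let R = refine relax split c ya az in record
      { above = X.<-trans xy (Refinement.above R) ; below = Refinement.below R
      ; chain = link xy xy′ (relax r) (Refinement.chain R) ; member = there (Refinement.member R)
      ; keeps = λ { (here p) → here p ; (there m) → there (Refinement.keeps R m) } }

EF-splits : ∀ {X X′ n} → Splits {X} {X′} (EF X X′ (suc n)) (EF X X′ n)
EF-splits (play _ back) = back

-- Making room for one order along a chain in another

Roomy : (X X′ : Order) → ℕ → IntervalRel X X′
Roomy X X′ n x y x′ y′ = Spread X (suc (types n)) x y ⊎ IntervalMap X′ X x′ y′ x y

module _ (em : ExcludedMiddle) {X X′ : Order} (n : ℕ) where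

  make-room : ∀ {x y x′ y′} → x′ <[ X′ ] y′ → Roomy X X′ n x y x′ y′ → Stretching X X′ n x y x′ y′
  make-room x′<y′ (inj₁ s) = stretch em n x′<y′ s
  make-room _     (inj₂ e) = record
    { target = X ; into = id ; inc = id
    ; left = λ _ _ → EF-refl n ; right = λ _ _ → EF-refl n ; inner = EF-refl n ; room = e }

module _ (em : ExcludedMiddle) {X X′ : Order} (n : ℕ) where
  private
    module X = Order X
    module X′ = Order X′

  -- `left` speaks of intervals that are still to be stretched: it guarantees that their types have
  -- survived when the recursion gets to them.
  record Realisation (x : Pt X) (x′ : Pt X′) (ps : List (Pt X × Pt X′)) (z : Pt X) (z′ : Pt X′) : Set₁ where
    field
      target : Order
      into   : Pt X → Pt target
      inc    : Increasing X target into
      left   : ∀ {p q} → p X.< q → ¬ (x X.< q) → EF X target n p q (into p) (into q)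
      links  : Chain X X′ (λ p q _ _ → EF X target n p q (into p) (into q)) x x′ ps z z′
      room   : IntervalMap X′ target x′ z′ (into x) (into z)
      agree  : ∀ {p p′} → (p , p′) ∈ ps → to room p′ ≡ into p

  -- The intervals are stretched from right to left; each step leaves the
  -- intervals on either side unchanged up to EF-equivalence.
  realise : ∀ {x x′ ps z z′} → Chain X X′ (Roomy X X′ n) x x′ ps z z′ → Realisation x x′ ps z z′
  realise (last p p′ r) = record
    { target = S.target ; into = S.into ; inc = S.inc ; left = S.left
    ; links = last p p′ S.inner ; room = S.room ; agree = λ () }
    where
    module S = Stretching (make-room em n p′ r)
  realise {x} {x′} {ps} {z} {z′} (link {y = y} {y′ = y′} {ps = qs} xy xy′ r c) = record
    { target = S.target
    ; into = into
    ; inc = S.inc ∘ R.inc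
    ; left = λ pq x≮q → EF-trans (R.left pq (λ yq → x≮q (X.<-trans xy yq)))
        (S.left (R.inc pq) (λ xq → x≮q (reflects xq)))
    ; links = link xy xy′ (EF-trans (R.left xy X.<-irrefl) S.inner) (extend (inj₂ refl) R.links)
    ; room = interval-glue (S.inc (R.inc xy)) (S.inc (R.inc (proj₁ (chain-< c)))) S.room rest
    ; agree = λ { (here refl) → glue-at (S.inc (R.inc xy)) (S.inc (R.inc (proj₁ (chain-< c)))) S.room rest
                ; (there m) → trans (glue-right (S.inc (R.inc xy)) (S.inc (R.inc (proj₁ (chain-< c)))) S.room rest
                                      (proj₂ (member-> c m)))
                                    (cong S.into (R.agree m)) }
    }
    where
    module R = Realisation (realise c)
    lifted : Roomy X X′ n x y x′ y′ → Roomy R.target X′ n (R.into x) (R.into y) x′ y′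
    lifted (inj₁ s) = inj₁ (spread-map R.inc s)
    lifted (inj₂ e) = inj₂ (interval-∘ R.inc e)
    -- The interval stretched next is the image of (x , y) in the order already built for the rest
    -- of the chain.
    module S = Stretching (make-room em {R.target} {X′} n xy′ (lifted r))
    into = S.into ∘ R.into
    rest = interval-∘ S.inc R.room
    reflects : ∀ {p q} → R.into p <[ R.target ] R.into q → p X.< q
    reflects {p} {q} r with X.compare p q
    ... | tri< pq _ _ = pq
    ... | tri≈ _ refl _ = contradiction r (Order.<-irrefl R.target)
    ... | tri> _ _ qp = contradiction (R.inc qp) (Order.<-asym R.target r)
    shift : ∀ {p q} → y X.≼ p → p X.< q → EF X R.target n p q (R.into p) (R.into q) →
      EF X S.target n p q (into p) (into q)
    shift yp pq e = EF-trans e (S.right (R.inc pq) λ r → X.<-irrefl (X.≼-<-trans yp (reflects r)))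
    extend : ∀ {p p′ qs z z′} → y X.≼ p →
      Chain X X′ (λ p q _ _ → EF X R.target n p q (R.into p) (R.into q)) p p′ qs z z′ →
      Chain X X′ (λ p q _ _ → EF X S.target n p q (into p) (into q)) p p′ qs z z′
    extend yp (last p p′ e)   = last p p′ (shift yp p e)
    extend yp (link p p′ e c) = link p p′ (shift yp p e) (extend (inj₁ (X.≼-<-trans yp p)) c)

-- Linear orders as strict orders with extrema adjoined

ext : {A B : Set} → (A → B) → A ± → B ±
ext f ⊥±    = ⊥±
ext f [ a ] = [ f a ]
ext f ⊤±    = ⊤±

toLinOrd : Order → LinOrd
toLinOrd X = record
  { Carrier = Pt X ; _≤_ = FromStrict._≤_ _≡_ (Order._<_ X)
  ; isTotalOrder = FromStrict.isTotalOrder _≡_ (Order._<_ X) (Order.isStrictTotalOrder X) }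

module _ (em : ExcludedMiddle) where

  toOrder : LinOrd → Order
  toOrder V = record
    { Pt = Carrier V ; _<_ = ToStrict._<_ _≡_ (LinOrd._≤_ V)
    ; isStrictTotalOrder = ToStrict.<-isStrictTotalOrder₁ _≡_ (LinOrd._≤_ V) (λ x y → em (x ≡ y)) (LinOrd.isTotalOrder V) }

  extended : LinOrd → Order
  extended V = record
    { Pt = Carrier V ± ; _<_ = Extrema._<±_ (Order._<_ (toOrder V))
    ; isStrictTotalOrder = Extrema.<±-isStrictTotalOrder-≡ _ (Order.isStrictTotalOrder (toOrder V)) }

  ≤⇒≼ : ∀ (V : LinOrd) {x y} → LinOrd._≤_ V x y → Order._≼_ (toOrder V) x y
  ≤⇒≼ V {x} {y} x≤y with em (x ≡ y)
  ... | yes x≡y = inj₂ x≡y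
  ... | no  x≢y = inj₁ (x≤y , x≢y)

  ≼⇒≤ : ∀ (V : LinOrd) {x y} → Order._≼_ (toOrder V) x y → LinOrd._≤_ V x y
  ≼⇒≤ V (inj₁ (x≤y , _)) = x≤y
  ≼⇒≤ V (inj₂ refl)      = IsTotalOrder.refl (LinOrd.isTotalOrder V)

  ↪-inc : ∀ {U V} (f : U ↪ V) → Increasing (toOrder U) (toOrder V) (fun f)
  ↪-inc {U} {V} f (x≤y , x≢y) = _↪_.mono f x≤y , λ fx≡fy →
    x≢y (IsTotalOrder.antisym (LinOrd.isTotalOrder U) x≤y
      (_↪_.reflect f (IsTotalOrder.reflexive (LinOrd.isTotalOrder V) (sym fx≡fy))))

  inc-↪ : ∀ {V X} (f : Carrier V → Pt X) → Increasing (toOrder V) X f → V ↪ toLinOrd X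
  inc-↪ {V} {X} f inc = record { fun = f ; mono = mono′ ; reflect = reflect }
    where
    mono′ : ∀ {x y} → LinOrd._≤_ V x y → LinOrd._≤_ (toLinOrd X) (f x) (f y)
    mono′ x≤y with ≤⇒≼ V x≤y
    ... | inj₁ x<y  = inj₁ (inc x<y)
    ... | inj₂ refl = inj₂ refl
    reflect : ∀ {x y} → LinOrd._≤_ (toLinOrd X) (f x) (f y) → LinOrd._≤_ V x y
    reflect {x} {y} fx≤fy with Order.compare (toOrder V) x y
    ... | tri< x<y _ _ = proj₁ x<y
    ... | tri≈ _ x≡y _ = ≼⇒≤ V (inj₂ x≡y)
    ... | tri> _ _ y<x = contradiction (Order.<-≼-trans X (inc y<x) fx≤fy) (Order.<-irrefl X)

  ext-inc : ∀ {U V} (f : Carrier U → Carrier V) → Increasing (toOrder U) (toOrder V) f →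
    Increasing (extended U) (extended V) (ext f)
  ext-inc f inc Extrema.⊥±<[ _ ] = Extrema.⊥±<[ _ ]
  ext-inc f inc Extrema.[ p ]    = Extrema.[ inc p ]
  ext-inc f inc Extrema.⊥±<⊤±    = Extrema.⊥±<⊤±
  ext-inc f inc Extrema.[ _ ]<⊤± = Extrema.[ _ ]<⊤±

  -- Stretching may create points beyond the images of the extrema. Cutting down to the open
  -- interval (l , h) gives a linear order whose extrema play the roles of `l` and `h`.
  module Interior (X : Order) (l h : Pt X) (l<h : l <[ X ] h) where
    private module X = Order X

    record Inner : Set where
      constructor inner
      field
        pt     : Pt X
        .above : l X.< pt
        .below : pt X.< h

    l<inner : (i : Inner) → l X.< Inner.pt i
    l<inner (inner u p _) = recompute (l X.<? u) p

    inner<h : (i : Inner) → Inner.pt i X.< h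
    inner<h (inner u _ p) = recompute (u X.<? h) p

    interior : Order
    interior = pullback X Inner.pt λ { {inner _ _ _} {inner _ _ _} refl → refl }

    back : Carrier (toLinOrd interior) ± → Pt X
    back ⊥±    = l
    back [ i ] = Inner.pt i
    back ⊤±    = h

    strict : ∀ {i j} → i <[ toOrder (toLinOrd interior) ] j → Inner.pt i X.< Inner.pt j
    strict (inj₁ p , _) = p
    strict (inj₂ p , q) = contradiction p q

    lax : ∀ {i j} → Inner.pt i X.< Inner.pt j → i <[ toOrder (toLinOrd interior) ] j
    lax p = inj₁ p , λ { refl → X.<-irrefl p }

    back-inc : Increasing (extended (toLinOrd interior)) X back
    back-inc Extrema.⊥±<[ i ] = l<inner i
    back-inc Extrema.[ p ]    = strict p
    back-inc Extrema.⊥±<⊤±    = l<h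
    back-inc Extrema.[ i ]<⊤± = inner<h i

    back-reflects : ∀ {i j} → back i X.< back j → i <[ extended (toLinOrd interior) ] j
    back-reflects {i} {j} p with Order.compare (extended (toLinOrd interior)) i j
    ... | tri< q _ _    = q
    ... | tri≈ _ refl _ = contradiction p X.<-irrefl
    ... | tri> _ _ q    = contradiction (back-inc {j} {i} q) (X.<-asym p)

    back-bounds : ∀ i → l X.≼ back i × back i X.≼ h
    back-bounds ⊥±    = inj₂ refl , inj₁ l<h
    back-bounds [ i ] = inj₁ (l<inner i) , inj₁ (inner<h i)
    back-bounds ⊤±    = inj₁ l<h , inj₂ refl

    EF-interior : ∀ n {i j} → EF X (extended (toLinOrd interior)) n (back i) (back j) i j
    EF-interior n {i} {j} = EF-iso (λ u k → u ≡ back k)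
      (λ { {a′ = k} {b′ = m} refl refl p → back-reflects {k} {m} p })
      (λ { {a′ = k} {b′ = m} refl refl p → back-inc {k} {m} p })
      (λ {a} p q →
        let k = [ inner a (X.≼-<-trans (proj₁ (back-bounds i)) p) (X.<-≼-trans q (proj₂ (back-bounds j))) ]
        in k , back-reflects {i} {k} p , back-reflects {k} {j} q , refl)
      (λ {k} p q → back k , back-inc {i} {k} p , back-inc {k} {j} q , refl) n

  -- `T` is the interior of the order that realises the chain. `V` embeds into it through `room`,
  -- whereas `U` is only compared with it, up to n rounds.
  amalgam : ∀ n {U V : LinOrd} {ps} → Chain (extended U) (extended V) (Roomy (extended U) (extended V) n) ⊥± ⊥± ps ⊤± ⊤± →
    Σ LinOrd λ T → Σ (V ↪ T) λ e →
      Chain (extended U) (extended T) (EF (extended U) (extended T) n) ⊥± ⊥± (map (Prod.map id (ext (fun e))) ps) ⊤± ⊤±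
  amalgam n {U} {V} {ps} c = toLinOrd interior , e , finish refl refl (λ m → m) R.links
    where
    module R = Realisation (realise em n c)
    open Interior R.target (R.into ⊥±) (R.into ⊤±) (R.inc Extrema.⊥±<⊤±)
    g : Carrier V → Inner
    g v = inner (to R.room [ v ]) (above R.room Extrema.⊥±<[ v ] Extrema.[ v ]<⊤±)
                                  (below R.room Extrema.⊥±<[ v ] Extrema.[ v ]<⊤±)
    g-inc : Increasing (toOrder V) interior g
    g-inc p = mono R.room Extrema.⊥±<[ _ ] Extrema.[ p ] Extrema.[ _ ]<⊤±
    e : V ↪ toLinOrd interior
    e = inc-↪ g g-inc
    agree : ∀ {p p′} → (p , p′) ∈ ps → back (ext g p′) ≡ R.into p
    -- Listed points lie strictly between the ends of the chain, so neither extremum is among them.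
    agree {p′ = ⊥±}    m = contradiction (proj₂ (member-> c m)) (Order.<-irrefl (extended V))
    agree {p′ = [ v ]} m = R.agree m
    agree {p′ = ⊤±}    m = contradiction (top c m) (Order.<-irrefl (extended V))
      where
      top : ∀ {P x x′ ps z z′ q q′} → Chain (extended U) (extended V) P x x′ ps z z′ → (q , q′) ∈ ps → q′ <[ extended V ] z′
      top (link _ _ _ c) (here refl) = proj₂ (chain-< c)
      top (link _ _ _ c) (there m)   = top c m
    inc′ : Increasing (extended V) (extended (toLinOrd interior)) (ext g)
    inc′ = ext-inc {V} {toLinOrd interior} g (λ p → lax (g-inc p))
    finish : ∀ {x x′ qs z z′} → back (ext g x′) ≡ R.into x → back (ext g z′) ≡ R.into z →
      (∀ {p} → p ∈ qs → p ∈ ps) →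
      Chain (extended U) (extended V) (λ p q _ _ → EF (extended U) R.target n p q (R.into p) (R.into q)) x x′ qs z z′ →
      Chain (extended U) (extended (toLinOrd interior)) (EF (extended U) (extended (toLinOrd interior)) n)
        x (ext g x′) (map (Prod.map id (ext g)) qs) z (ext g z′)
    step : ∀ {x x′ y y′} → back (ext g x′) ≡ R.into x → back (ext g y′) ≡ R.into y →
      EF (extended U) R.target n x y (R.into x) (R.into y) →
      EF (extended U) (extended (toLinOrd interior)) n x y (ext g x′) (ext g y′)
    step {x} {x′} {y} {y′} eq₁ eq₂ E = EF-trans
      (subst₂ (EF (extended U) R.target n x y) (sym eq₁) (sym eq₂) E) (EF-interior n {ext g x′} {ext g y′})
    finish eq₁ eq₂ sub (last p p′ E) = last p (inc′ p′) (step eq₁ eq₂ E)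
    finish eq₁ eq₂ sub (link p p′ E c) =
      link p (inc′ p′) (step eq₁ (agree (sub (here refl))) E) (finish (agree (sub (here refl))) eq₂ (sub ∘ there) c)

-- Preservation of modal formulas

constsᵗ : ∀ {C n} → Term C n → List C
constsᵗ (var _) = []
constsᵗ (con c) = c ∷ []

consts : ∀ {C n} → Fm C n → List C
consts ⊥'       = []
consts (s ≤' t) = constsᵗ s ++ constsᵗ t
consts (s ≐ t)  = constsᵗ s ++ constsᵗ t
consts (φ ⇒ ψ)  = consts φ ++ consts ψ
consts (∀' φ)   = consts φ
consts (□' φ)   = consts φ

-- A box costs as many rounds as are needed to tell whether an interval has
-- enough points to be stretched.
rank : ∀ {C n} → Fm C n → ℕ
rank ⊥'       = 0
rank (s ≤' t) = 0
rank (s ≐ t)  = 0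
rank (φ ⇒ ψ)  = rank φ ⊔ rank ψ
rank (∀' φ)   = suc (rank φ)
rank (□' φ)   = suc (types (rank φ))

Paired : ∀ {A B I : Set} → List (A ± × B ±) → (I → A) → (I → B) → (I → Set) → Set
Paired ps f g I = ∀ i → I i → ([ f i ] , [ g i ]) ∈ ps

paired-eval : ∀ {C n} {V V′ : LinOrd} {κ : C → Carrier V} {κ′ : C → Carrier V′}
  {ρ : Fin n → Carrier V} {ρ′ : Fin n → Carrier V′} {ps} (t : Term C n) →
  Paired ps κ κ′ (_∈ constsᵗ t) → Paired ps ρ ρ′ (λ _ → ⊤) → ([ eval V κ ρ t ] , [ eval V′ κ′ ρ′ t ]) ∈ ps
paired-eval (var i) _ mρ = mρ i _
paired-eval (con c) mκ _ = mκ c (here refl)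

id-↪ : ∀ {U} → U ↪ U
id-↪ = record { fun = id ; mono = id ; reflect = id }

_∘-↪_ : ∀ {U V T} → V ↪ T → U ↪ V → U ↪ T
g ∘-↪ f = record
  { fun = fun g ∘ fun f ; mono = _↪_.mono g ∘ _↪_.mono f ; reflect = _↪_.reflect f ∘ _↪_.reflect g }

module _ (em : ExcludedMiddle) where

  record Similar (V V′ : LinOrd) (n : ℕ) (ps : List (Carrier V ± × Carrier V′ ±)) : Set where
    constructor similar
    field
      chain : Chain (extended em V) (extended em V′) (EF (extended em V) (extended em V′) n) ⊥± ⊥± ps ⊤± ⊤±

  similar-sym : ∀ {V V′ n ps} → Similar V V′ n ps → Similar V′ V n (map swap ps)
  similar-sym (similar c) = similar (chain-swap EF-sym c)

  similar-lower : ∀ {V V′ m n ps} → m ≤ n → Similar V V′ n ps → Similar V V′ m ps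
  similar-lower m≤n (similar c) = similar (chain-relax (EF-lower m≤n) c)

  similar-≤ : ∀ {V V′ n ps x y x′ y′} → Similar V V′ n ps → ([ x ] , [ x′ ]) ∈ ps → ([ y ] , [ y′ ]) ∈ ps →
    LinOrd._≤_ V x y → LinOrd._≤_ V′ x′ y′
  similar-≤ {V} {V′} (similar c) mx my x≤y with members-compare c mx my
  ... | before _ p    = proj₁ (Extrema.[<]-injective _ p)
  ... | same _ refl = ≼⇒≤ em V′ (inj₂ refl)
  ... | after p _    = contradiction
    (Order.<-≼-trans (toOrder em V) (Extrema.[<]-injective _ p) (≤⇒≼ em V x≤y)) (Order.<-irrefl (toOrder em V))

  similar-≡ : ∀ {V V′ n ps x y x′ y′} → Similar V V′ n ps → ([ x ] , [ x′ ]) ∈ ps → ([ y ] , [ y′ ]) ∈ ps →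
    x ≡ y → x′ ≡ y′
  similar-≡ {V} (similar c) mx my refl with members-compare c mx my
  ... | before p _ = contradiction p (Order.<-irrefl (extended em V))
  ... | same _ q = [_]-injective q
  ... | after p _ = contradiction p (Order.<-irrefl (extended em V))

  inner-point : ∀ (V : LinOrd) {p} → ⊥± <[ extended em V ] p → p <[ extended em V ] ⊤± → ∃ λ v → p ≡ [ v ]
  inner-point V Extrema.⊥±<[ v ] _ = v , refl
  inner-point V Extrema.⊥±<⊤± p = contradiction p (Order.<-irrefl (extended em V))

  -- By `spread-or-map`, each gap of `V′` either has enough points to be stretched, and then so has
  -- its image in `U′`, or it receives the matching gap of `V`. Hence `V` fits into an order similar
  -- to `U′`.
  similar-extend : ∀ n {V V′ U′ ps} → Similar V V′ (suc (types n)) ps → (f : V′ ↪ U′) →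
    Σ LinOrd λ U → Σ (V ↪ U) λ e → ∃ λ qs → Similar U U′ n qs ×
      (∀ {v v′} → ([ v ] , [ v′ ]) ∈ ps → ([ fun e v ] , [ fun f v′ ]) ∈ qs)
  similar-extend n {V} {V′} {U′} c f =
    let U , e , c′ = amalgam em n {U′} {V} (chain-map {Q = Roomy (extended em U′) (extended em V) n} f-inc id (λ _ → room) (Similar.chain (similar-sym c)))
    in U , e , _ , similar-sym (similar c′) , λ m → ∈-map⁺ swap (∈-map⁺ (Prod.map id (ext (fun e)))
                                            (∈-map⁺ (Prod.map (ext (fun f)) id) (∈-map⁺ swap m)))
    where
    f-inc : Increasing (extended em V′) (extended em U′) (ext (fun f))
    f-inc = ext-inc em {V′} {U′} (fun f) (↪-inc em f)
    room : ∀ {x y x′ y′} → EF (extended em V′) (extended em V) (suc (types n)) x y x′ y′ →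
      Roomy (extended em U′) (extended em V) n (ext (fun f) x) (ext (fun f) y) x′ y′
    room E with spread-or-map em _ E
    ... | inj₁ s = inj₁ (spread-map f-inc s)
    ... | inj₂ e = inj₂ (interval-∘ f-inc e)

  -- Premises of implications are carried back along the swapped chain, a quantifier inserts its
  -- point into the chain, and an extension of `V′` is answered by one of `V`.
  preserve : ∀ {C n} (φ : Fm C n) {V V′ κ κ′ ρ ρ′ ps} → Similar V V′ (rank φ) ps →
    Paired ps κ κ′ (_∈ consts φ) → Paired ps ρ ρ′ (λ _ → ⊤) → Sat V κ ρ φ → Sat V′ κ′ ρ′ φ
  preserve ⊥' c mκ mρ h = h
  preserve (s ≤' t) c mκ mρ (lift h) = lift (similar-≤ c
    (paired-eval s (λ c → mκ c ∘ ∈-++⁺ˡ) mρ) (paired-eval t (λ c → mκ c ∘ ∈-++⁺ʳ (constsᵗ s)) mρ) h)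
  preserve (s ≐ t) c mκ mρ (lift h) = lift (similar-≡ c
    (paired-eval s (λ c → mκ c ∘ ∈-++⁺ˡ) mρ) (paired-eval t (λ c → mκ c ∘ ∈-++⁺ʳ (constsᵗ s)) mρ) h)
  preserve (φ ⇒ ψ) c mκ mρ h s = preserve ψ (similar-lower (ℕₚ.m≤n⊔m (rank φ) _) c)
    (λ c → mκ c ∘ ∈-++⁺ʳ (consts φ)) mρ
    (h (preserve φ (similar-sym (similar-lower (ℕₚ.m≤m⊔n _ (rank ψ)) c))
      (λ c → ∈-map⁺ swap ∘ mκ c ∘ ∈-++⁺ˡ) (λ i → ∈-map⁺ swap ∘ mρ i) s))
  preserve (∀' φ) {V} (similar c) mκ mρ h a′
    with refine (EF-lower (ℕₚ.n≤1+n _)) EF-splits c Extrema.⊥±<[ a′ ] Extrema.[ a′ ]<⊤±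
  ... | R with inner-point V (Refinement.above R) (Refinement.below R)
  ...   | a , refl = preserve φ (similar (Refinement.chain R)) (λ c → Refinement.keeps R ∘ mκ c)
    (λ { zero _ → Refinement.member R ; (suc i) _ → Refinement.keeps R (mρ i _) }) (h a)
  preserve (□' φ) c mκ mρ h U′ f =
    let U , e , qs , c′ , m = similar-extend (rank φ) c f
    in preserve φ c′ (λ c → m ∘ mκ c) (λ i → m ∘ mρ i) (h U e)

  -- Soundness of S5 over a dense order without endpoints

  module _ {W : LinOrd} (dlo : IsNonemptyDLOWithoutEndpoints W) where
    open IsNonemptyDLOWithoutEndpoints dlo

    between : ∀ {x y} → x <[ extended em W ] y → ∃ λ z → x <[ extended em W ] z × z <[ extended em W ] y
    between Extrema.⊥±<[ y ] = let z , p = noLeast y in [ z ] , Extrema.⊥±<[ z ] , Extrema.[ p ]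
    between Extrema.[ p ]    = let z , q , r = dense _ _ p in [ z ] , Extrema.[ q ] , Extrema.[ r ]
    between Extrema.⊥±<⊤±    = [ nonempty ] , Extrema.⊥±<[ _ ] , Extrema.[ _ ]<⊤±
    between Extrema.[ x ]<⊤± = let z , p = noGreatest x in [ z ] , Extrema.[ p ] , Extrema.[ z ]<⊤±

    dense-spread : ∀ k {x y} → x <[ extended em W ] y → Spread (extended em W) k x y
    dense-spread zero    _   = none
    dense-spread (suc k) x<y = let z , p , q = between x<y in more p q (dense-spread k q)

    Diagonal : IntervalRel (extended em W) (extended em W)
    Diagonal x y x′ y′ = x ≡ x′ × y ≡ y′

    diagonal-member : ∀ {x x′ ps z z′ p p′} → Chain (extended em W) (extended em W) Diagonal x x′ ps z z′ →
      (p , p′) ∈ ps → p ≡ p′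
    diagonal-member (link _ _ (_ , q) _) (here refl) = q
    diagonal-member (link _ _ _ c)       (there m)   = diagonal-member c m

    diagonal : (cs : List (Carrier W)) → ∃ λ ps →
      Chain (extended em W) (extended em W) Diagonal ⊥± ⊥± ps ⊤± ⊤± × (∀ {c} → c ∈ cs → ([ c ] , [ c ]) ∈ ps)
    diagonal [] = [] , last Extrema.⊥±<⊤± Extrema.⊥±<⊤± (refl , refl) , λ ()
    diagonal (c ∷ cs) with diagonal cs
    ... | ps , ch , m with refine id (λ { (refl , refl) p q → _ , p , q , (refl , refl) , (refl , refl) })
                                  ch Extrema.⊥±<[ c ] Extrema.[ c ]<⊤±
    ...   | R with diagonal-member (Refinement.chain R) (Refinement.member R)
    ...     | refl = _ , Refinement.chain R ,
      λ { (here refl) → Refinement.member R ; (there n) → Refinement.keeps R (m n) }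

    -- The constants cut `W` into gaps that contain arbitrarily many points by density, and so do
    -- their images in `V`. Every gap of `V` can therefore be stretched to take in the matching gap
    -- of `U`.
    similar-return : ∀ n (cs : List (Carrier W)) {V U} (f : W ↪ V) (g : V ↪ U) →
      Σ LinOrd λ T → Σ (U ↪ T) λ e → ∃ λ ps → Similar T V n ps ×
        (∀ c → c ∈ cs → ([ fun e (fun g (fun f c)) ] , [ fun f c ]) ∈ ps)
    similar-return n cs {V} {U} f g with diagonal cs
    ... | ps , ch , m =
      let T , e , c = amalgam em n {V} {U} (chain-map {Q = Roomy (extended em V) (extended em U) n} f-inc gf-inc
                        (λ x<y _ → inj₁ (spread-map f-inc (dense-spread _ x<y))) ch)
      in T , e , _ , similar-sym (similar c) , λ c m′ →
           ∈-map⁺ swap (∈-map⁺ (Prod.map id (ext (fun e))) (∈-map⁺ (Prod.map (ext (fun f)) (ext (fun g ∘ fun f))) (m m′)))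
      where
      f-inc : Increasing (extended em W) (extended em V) (ext (fun f))
      f-inc = ext-inc em {W} {V} (fun f) (↪-inc em f)
      gf-inc : Increasing (extended em W) (extended em U) (ext (fun g ∘ fun f))
      gf-inc = ext-inc em {W} {U} (fun g ∘ fun f) (↪-inc em g ∘ ↪-inc em f)

    -- Claimed at every extension of `W`, so that necessitation goes through. Density enters with
    -- axiom B.
    sound : ((P : Set₁) → P ⊎ ¬ P) → ∀ {A} → S5⊢ A → (σ : ℕ → Fm (Carrier W) 0) →
      ∀ {V} (f : W ↪ V) ρ → Sat V (fun f) ρ (inst σ A)
    sound lem (ax1 A B) σ f ρ = λ a b → a
    sound lem (ax2 A B D) σ f ρ = λ a b c → a c (b c)
    sound lem (ax3 A) σ {V} f ρ h with lem (Sat V (fun f) ρ (inst σ A))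
    ... | inj₁ a  = a
    ... | inj₂ ¬a = ⊥-elim (lower (h (lift ∘ ¬a)))
    sound lem (axK A B) σ f ρ = λ h k U g → h U g (k U g)
    sound lem (axT A) σ {V} f ρ = λ h → h V id-↪
    sound lem (ax4 A) σ f ρ = λ h U g T k → h T (k ∘-↪ g)
    sound lem (axB A) σ {V} f ρ h
      with lem (Σ LinOrd λ U → Σ (V ↪ U) λ g → Sat U (fun g ∘ fun f) (fun g ∘ ρ) (□' (inst σ A)))
    ... | inj₂ none′ = ⊥-elim (lower (h (λ U g k → lift (none′ (U , g , k)))))
    ... | inj₁ (U , g , k) =
      -- `T` extends `U`, where the box holds, and is similar to `V`, to which the formula is then
      -- carried back.
      let T , e , ps , c , m = similar-return (rank (inst σ A)) (consts (inst σ A)) f g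
      in preserve (inst σ A) c m (λ ()) (k T e)
    sound lem (mp d d′) σ f ρ = sound lem d σ f ρ (sound lem d′ σ f ρ)
    sound lem (nec d) σ f ρ = λ U g → sound lem d σ (g ∘-↪ f) (fun g ∘ ρ)

-- Finite countermodels for S5

infix 3 _⊢_

-- Necessitation applies to theorems only, never to hypotheses, which makes the deduction theorem
-- `deduce` hold.
data _⊢_ (Γ : List PFm) : PFm → Set where
  hyp : ∀ {A} → A ∈ Γ → Γ ⊢ A
  thm : ∀ {A} → S5⊢ A → Γ ⊢ A
  app : ∀ {A B} → Γ ⊢ A ⇒ₚ B → Γ ⊢ A → Γ ⊢ B

weaken : ∀ {Γ Δ A} → (∀ {B} → B ∈ Γ → B ∈ Δ) → Γ ⊢ A → Δ ⊢ A
weaken s (hyp m)   = hyp (s m)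
weaken s (thm d)   = thm d
weaken s (app d e) = app (weaken s d) (weaken s e)

deduce : ∀ {Γ A B} → A ∷ Γ ⊢ B → Γ ⊢ A ⇒ₚ B
deduce {A = A} (hyp (here refl)) = thm (mp (mp (ax2 A (A ⇒ₚ A) A) (ax1 A (A ⇒ₚ A))) (ax1 A A))
deduce (hyp (there m))           = app (thm (ax1 _ _)) (hyp m)
deduce (thm d)                   = app (thm (ax1 _ _)) (thm d)
deduce (app d e)                 = app (app (thm (ax2 _ _ _)) (deduce d)) (deduce e)

closed : ∀ {A} → [] ⊢ A → S5⊢ A
closed (hyp ())
closed (thm d)   = d
closed (app d e) = mp (closed d) (closed e)

by-contradiction : ∀ {Γ A} → ¬ₚ A ∷ Γ ⊢ ⊥ₚ → Γ ⊢ A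
by-contradiction d = app (thm (ax3 _)) (deduce d)

explode : ∀ {Γ A} → Γ ⊢ ⊥ₚ → Γ ⊢ A
explode d = by-contradiction (weaken there d)

contrapose : ∀ {A B} → S5⊢ (A ⇒ₚ B) → S5⊢ (¬ₚ B ⇒ₚ ¬ₚ A)
contrapose d = closed (deduce (deduce (app (hyp (there (here refl))) (app (thm d) (hyp (here refl))))))

-- ◇□A → ◇□□A → □A, contraposed.
negative-introspection : ∀ A → S5⊢ (¬ₚ (□ₚ A) ⇒ₚ □ₚ (¬ₚ (□ₚ A)))
negative-introspection A = closed (deduce (by-contradiction
  (app (hyp (there (here refl))) (app (thm (axB (□ₚ A))) (app (thm ◇-mono) (hyp (here refl)))))))
  where
  ◇-mono : S5⊢ (◇ₚ (□ₚ A) ⇒ₚ ◇ₚ (□ₚ (□ₚ A)))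
  ◇-mono = contrapose (mp (axK _ _) (nec (contrapose (ax4 A))))

Stable : PFm → Set
Stable A = S5⊢ (A ⇒ₚ □ₚ A)

necessitate : ∀ {Γ A} → (∀ {B} → B ∈ Γ → Stable B) → Γ ⊢ A → Γ ⊢ □ₚ A
necessitate st (hyp m)   = app (thm (st m)) (hyp m)
necessitate st (thm d)   = thm (nec d)
necessitate st (app d e) = app (app (thm (axK _ _)) (necessitate st d)) (necessitate st e)

sub : PFm → List PFm
sub (pv i)   = pv i ∷ []
sub ⊥ₚ       = ⊥ₚ ∷ []
sub (A ⇒ₚ B) = (A ⇒ₚ B) ∷ sub A ++ sub B
sub (□ₚ A)   = □ₚ A ∷ sub A

∈-sub : ∀ A → A ∈ sub A
∈-sub (pv i)   = here refl
∈-sub ⊥ₚ       = here refl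
∈-sub (A ⇒ₚ B) = here refl
∈-sub (□ₚ A)   = here refl

Valuation : Set
Valuation = ℕ → Bool

-- Kripke semantics on a finite frame in which every world sees every world; the worlds are
-- identified with their valuations.
Forces : List Valuation → Valuation → PFm → Set
Forces Θs Θ (pv i)   = Θ i ≡ true
Forces Θs Θ ⊥ₚ       = ⊥
Forces Θs Θ (A ⇒ₚ B) = Forces Θs Θ A → Forces Θs Θ B
Forces Θs Θ (□ₚ A)   = ∀ {Ξ} → Ξ ∈ Θs → Forces Θs Ξ A

Consistent : List PFm → Set
Consistent Γ = ¬ (Γ ⊢ ⊥ₚ)

module _ (em : ExcludedMiddle) where

  record Settled (Σs Γ : List PFm) : Set where
    field
      added      : List PFm
      consistent : Consistent (added ++ Γ)
      settles    : ∀ {A} → A ∈ Σs → A ∈ added ⊎ ¬ₚ A ∈ added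
      origin     : ∀ {D} → D ∈ added → ∃ λ A → A ∈ Σs × (D ≡ A ⊎ D ≡ ¬ₚ A)

  -- Lindenbaum's construction for a finite list: the negation is added when it is derivable, and
  -- the formula itself otherwise, which is then consistent by the deduction theorem.
  settle : ∀ Σs {Γ} → Consistent Γ → Settled Σs Γ
  settle [] ok = record { added = [] ; consistent = ok ; settles = λ () ; origin = λ () }
  settle (A ∷ Σs) {Γ} ok with settle Σs ok
  ... | S with em (Settled.added S ++ Γ ⊢ ¬ₚ A)
  ...   | yes ¬A = record
    { added = ¬ₚ A ∷ Settled.added S
    ; consistent = λ d → Settled.consistent S (app (deduce d) ¬A)
    ; settles = λ { (here refl) → inj₂ (here refl)
                  ; (there m) → Sum.map there there (Settled.settles S m) }
    ; origin = λ { (here refl) → A , here refl , inj₂ refl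
                 ; (there m) → let B , n , eq = Settled.origin S m in B , there n , eq } }
  ...   | no ⊬¬A = record
    { added = A ∷ Settled.added S
    ; consistent = λ d → ⊬¬A (deduce d)
    ; settles = λ { (here refl) → inj₁ (here refl)
                  ; (there m) → Sum.map there there (Settled.settles S m) }
    ; origin = λ { (here refl) → A , here refl , inj₁ refl
                 ; (there m) → let B , n , eq = Settled.origin S m in B , there n , eq } }

  module Countermodel (ψ : PFm) (⊬ψ : ¬ (S5⊢ ψ)) where

    -- The boxed formulas are settled once, before any world is built. All worlds share these
    -- decisions, so every world may see every other.
    modal : Settled (map □ₚ (sub ψ)) (¬ₚ ψ ∷ [])
    modal = settle (map □ₚ (sub ψ)) (λ d → ⊬ψ (closed (by-contradiction d)))

    Δ : List PFm
    Δ = Settled.added modal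

    Δ-stable : ∀ {D} → D ∈ Δ → Stable D
    Δ-stable m with Settled.origin modal m
    ... | A , n , eq with ∈-map⁻ □ₚ n
    Δ-stable m | _ , _ , inj₁ refl | B , _ , refl = ax4 B
    Δ-stable m | _ , _ , inj₂ refl | B , _ , refl = negative-introspection B

    Δ-consistent : Consistent Δ
    Δ-consistent d = Settled.consistent modal (weaken ∈-++⁺ˡ d)

    record World : Set where
      field
        theory     : List PFm
        consistent : Consistent theory
        modal⊆     : ∀ {D} → D ∈ Δ → D ∈ theory
        decides    : ∀ {A} → A ∈ sub ψ → A ∈ theory ⊎ ¬ₚ A ∈ theory

    open World

    world : ∀ {Γ} → Consistent Γ → (∀ {D} → D ∈ Δ → D ∈ Γ) → Σ World λ w → ∀ {A} → A ∈ Γ → A ∈ theory w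
    world {Γ} ok Δ⊆ = record
      { theory = Settled.added S ++ Γ
      ; consistent = Settled.consistent S
      ; modal⊆ = ∈-++⁺ʳ (Settled.added S) ∘ Δ⊆
      ; decides = λ m → Sum.map ∈-++⁺ˡ ∈-++⁺ˡ (Settled.settles S m) } , ∈-++⁺ʳ (Settled.added S)
      where
      S = settle (sub ψ) ok

    actual : Σ World λ w → ¬ₚ ψ ∈ theory w
    actual = let w , Γ⊆ = world (Settled.consistent modal) ∈-++⁺ˡ in w , Γ⊆ (∈-++⁺ʳ Δ (here refl))

    -- Were `¬ₚ B` inconsistent with `Δ`, then `Δ` would prove `B` and, its members being stable,
    -- also `□ₚ B`.
    refuting : ∀ {B} → Δ ⊢ ¬ₚ (□ₚ B) → Σ World λ w → ¬ₚ B ∈ theory w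
    refuting d = let w , Γ⊆ = world (λ e → Δ-consistent (app d (necessitate Δ-stable (by-contradiction e)))) there
                 in w , Γ⊆ (here refl)

    witnesses : ∀ Bs → ∃ λ ws → ∀ {B} → B ∈ Bs → Δ ⊢ ¬ₚ (□ₚ B) → ∃ λ w → w ∈ ws × ¬ₚ B ∈ theory w
    witnesses [] = [] , λ ()
    witnesses (B ∷ Bs) with witnesses Bs | em (Δ ⊢ ¬ₚ (□ₚ B))
    ... | ws , f | no ⊬ = ws , λ { (here refl) d → contradiction d ⊬ ; (there m) → f m }
    ... | ws , f | yes d = let w , n = refuting d in w ∷ ws ,
      λ { (here refl) _ → w , here refl , n
        ; (there m) e → let w′ , k , n′ = f m e in w′ , there k , n′ }

    worlds : List World
    worlds = proj₁ actual ∷ proj₁ (witnesses (sub ψ))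

    valuation : World → Valuation
    valuation w i with em (theory w ⊢ pv i)
    ... | yes _ = true
    ... | no  _ = false

    Model : List Valuation
    Model = map valuation worlds

    absurd : ∀ {w A} {P : Set} → theory w ⊢ A → ¬ₚ A ∈ theory w → P
    absurd {w} d m = ⊥-elim (consistent w (app (hyp m) d))

    -- For a box, `Δ` has decided the matter: a box in `Δ` is in every theory and yields its body by
    -- T, and the negation of one has a witness among `worlds`.
    truth : ∀ A → (∀ {B} → B ∈ sub A → B ∈ sub ψ) → ∀ {w} → w ∈ worlds →
      (Forces Model (valuation w) A → theory w ⊢ A) × (theory w ⊢ A → Forces Model (valuation w) A)
    truth (pv i) s {w} _ with em (theory w ⊢ pv i)
    ... | yes d = (λ _ → d) , (λ _ → refl)
    ... | no ⊬  = (λ ()) , λ d → contradiction d ⊬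
    truth ⊥ₚ s {w} _ = (λ ()) , consistent w
    truth (A ⇒ₚ B) s {w} m = left , λ d f → proj₂ ihB (app d (proj₁ ihA f))
      where
      ihA = truth A (s ∘ there ∘ ∈-++⁺ˡ) m
      ihB = truth B (s ∘ there ∘ ∈-++⁺ʳ (sub A)) m
      left : (Forces Model (valuation w) A → Forces Model (valuation w) B) → theory w ⊢ A ⇒ₚ B
      left f with decides w (s (there (∈-++⁺ˡ (∈-sub A))))
      ... | inj₁ a  = deduce (weaken there (proj₁ ihB (f (proj₂ ihA (hyp a)))))
      ... | inj₂ ¬a = deduce (explode (app (hyp (there ¬a)) (hyp (here refl))))
    truth (□ₚ A) s {w} m with Settled.settles modal (∈-map⁺ □ₚ (s (there (∈-sub A))))
    ... | inj₁ □A = (λ _ → hyp (modal⊆ w □A)) , λ _ n → all n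
      where
      all : ∀ {Ξ} → Ξ ∈ Model → Forces Model Ξ A
      all n with ∈-map⁻ valuation n
      ... | v , k , refl = proj₂ (truth A (s ∘ there) k) (app (thm (axT A)) (hyp (modal⊆ v □A)))
    ... | inj₂ ¬□A = (λ f → refuted f) , λ d → absurd {w} d (modal⊆ w ¬□A)
      where
      refuted : Forces Model (valuation w) (□ₚ A) → theory w ⊢ □ₚ A
      refuted f with proj₂ (witnesses (sub ψ)) (s (there (∈-sub A))) (hyp ¬□A)
      ... | v , k , ¬A = absurd {v} (proj₁ (truth A (s ∘ there) (there k)) (f (∈-map⁺ valuation (there k)))) ¬A

    refutes : ¬ Forces Model (valuation (proj₁ actual)) ψ
    refutes f = absurd {proj₁ actual} (proj₁ (truth ψ id (here refl)) f) (proj₂ actual)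

  countermodel : ∀ {ψ} → ¬ (S5⊢ ψ) → ∃₂ λ Θ Θs → ¬ Forces (Θ ∷ Θs) Θ ψ
  countermodel {ψ} ⊬ψ = _ , _ , Countermodel.refutes ψ ⊬ψ

-- A dial of sentences: the number of iterated immediate successors

record Succ (V : LinOrd) (x y : Carrier V) : Set where
  constructor succ
  field
    below : LinOrd._≤_ V x y
    apart : ¬ (x ≡ y)
    least : ∀ z → ¬ LinOrd._≤_ V z x → LinOrd._≤_ V y z

wk : ∀ {C n} → Term C n → Term C (suc n)
wk (var i) = var (suc i)
wk (con c) = con c

eval-wk : ∀ {C n} (V : LinOrd) (κ : C → Carrier V) ρ a (t : Term C n) → eval V κ (a Vec.∷ ρ) (wk t) ≡ eval V κ ρ t
eval-wk V κ ρ a (var i) = refl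
eval-wk V κ ρ a (con c) = refl

-- In φ, `var zero` is the successor of x.
∀succ : ∀ {C n} → Term C n → Fm C (suc n) → Fm C n
∀succ x φ = ∀' ((wk x ≤' var zero) ⇒ (¬' (wk x ≐ var zero) ⇒
  (∀' (¬' (var zero ≤' wk (wk x)) ⇒ (var (suc zero) ≤' var zero)) ⇒ φ)))

module _ {C : Set} {n : ℕ} {V : LinOrd} {κ : C → Carrier V} {ρ : Fin n → Carrier V} (x : Term C n) (φ : Fm C (suc n)) where

  private
    eval-wk² : ∀ y z → eval V κ (z Vec.∷ y Vec.∷ ρ) (wk (wk x)) ≡ eval V κ ρ x
    eval-wk² y z = trans (eval-wk V κ (y Vec.∷ ρ) z (wk x)) (eval-wk V κ ρ y x)

  ∀succ-intro : (∀ {y} → Succ V (eval V κ ρ x) y → Sat V κ (y Vec.∷ ρ) φ) → Sat V κ ρ (∀succ x φ)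
  ∀succ-intro h y (lift p) q r = h (succ
    (subst (λ u → LinOrd._≤_ V u y) (eval-wk V κ ρ y x) p)
    (λ x≡y → lower (q (lift (trans (eval-wk V κ ρ y x) x≡y))))
    (λ z z≰x → lower (r z (λ s → lift (z≰x (subst (LinOrd._≤_ V z) (eval-wk² y z) (lower s)))))))

  ∀succ-elim : Sat V κ ρ (∀succ x φ) → ∀ {y} → Succ V (eval V κ ρ x) y → Sat V κ (y Vec.∷ ρ) φ
  ∀succ-elim h {y} (succ p q r) = h y
    (lift (subst (λ u → LinOrd._≤_ V u y) (sym (eval-wk V κ ρ y x)) p))
    (λ s → lift (q (trans (sym (eval-wk V κ ρ y x)) (lower s))))
    (λ z s → lift (r z (λ z≤x → lower (s (lift (subst (LinOrd._≤_ V z) (sym (eval-wk² y z)) z≤x))))))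

-- The entry of Θ ∷ Θs whose index is the number of times one can pass from x
-- to an immediate successor, capped at the length of Θs.
data Dial (V : LinOrd) : Carrier V → Valuation → List Valuation → Valuation → Set where
  end  : ∀ {x Θ} → Dial V x Θ [] Θ
  stop : ∀ {x Θ Θ′ Θs} → (∀ {y} → ¬ Succ V x y) → Dial V x Θ (Θ′ ∷ Θs) Θ
  step : ∀ {x y Θ Θ′ Θs Ξ} → Succ V x y → Dial V y Θ′ Θs Ξ → Dial V x Θ (Θ′ ∷ Θs) Ξ

-- Says that the valuation shown by the dial makes letter `i` true. Universal and existential forms
-- agree when `x` has a successor. When it has none, the first is true and the second false, so
-- choosing by `Θ i` gives the value that `Θ` prescribes.
dial : ∀ {C n} → Valuation → List Valuation → ℕ → Term C n → Fm C n
dial Θ [] i x with Θ i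
... | true  = ¬' ⊥'
... | false = ⊥'
dial Θ (Θ′ ∷ Θs) i x with Θ i
... | true  = ∀succ x (dial Θ′ Θs i (var zero))
... | false = ¬' (∀succ x (¬' (dial Θ′ Θs i (var zero))))

succ-unique : ∀ {V x y y′} → Succ V x y → Succ V x y′ → y ≡ y′
succ-unique {V} (succ p q r) (succ p′ q′ r′) = antisym (r _ (λ y≤x → q′ (antisym p′ y≤x))) (r′ _ (λ y≤x → q (antisym p y≤x)))
  where antisym = IsTotalOrder.antisym (LinOrd.isTotalOrder V)

dial-sat : ∀ {C n} {V : LinOrd} {κ : C → Carrier V} {ρ : Fin n → Carrier V} (x : Term C n) {Θ Θs Ξ} i →
  Dial V (eval V κ ρ x) Θ Θs Ξ →
  (Ξ i ≡ true → Sat V κ ρ (dial Θ Θs i x)) × (Ξ i ≡ false → ¬ Sat V κ ρ (dial Θ Θs i x))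
dial-sat x {Θ} i end with Θ i
... | true  = (λ _ h → h) , λ ()
... | false = (λ ()) , λ _ h → lower h
dial-sat x {Θ} {Θ′ ∷ Θs} i (stop no-succ) with Θ i
... | true  = (λ _ → ∀succ-intro x φ (⊥-elim ∘ no-succ)) , λ ()
  where φ = dial Θ′ Θs i (var zero)
... | false = (λ ()) , λ _ h → lower (h (∀succ-intro x (¬' φ) (⊥-elim ∘ no-succ)))
  where φ = dial Θ′ Θs i (var zero)
dial-sat {V = V} {κ} {ρ} x {Θ} {Θ′ ∷ Θs} {Ξ} i (step {y = y} s d)
  with Θ i | dial-sat {κ = κ} {ρ = y Vec.∷ ρ} (var zero) i d
... | true  | pos , neg =
  (λ eq → ∀succ-intro x φ (λ s′ → subst (λ v → Sat V κ (v Vec.∷ ρ) φ) (succ-unique s s′) (pos eq))) ,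
  λ eq h → neg eq (∀succ-elim x φ h s)
  where φ = dial Θ′ Θs i (var zero)
... | false | pos , neg =
  (λ eq h → ∀succ-elim x (¬' φ) h s (pos eq)) ,
  λ eq h → lower (h (∀succ-intro x (¬' φ) (λ s′ k →
    lift (neg eq (subst (λ v → Sat V κ (v Vec.∷ ρ) φ) (succ-unique s′ s) k)))))
  where φ = dial Θ′ Θs i (var zero)

Bool-order : Order
Bool-order = record { Pt = Bool ; _<_ = Bool._<_ ; isStrictTotalOrder = Bool-isStrictTotalOrder }

ℕᵒᵖ : Order
ℕᵒᵖ = record { Pt = ℕ ; _<_ = λ i j → j ℕ.< i ; isStrictTotalOrder = Flip.isStrictTotalOrder ℕₚ.<-isStrictTotalOrder }

module _ (em : ExcludedMiddle) where

  dial-total : ∀ V x Θ Θs → ∃ λ Ξ → Dial V x Θ Θs Ξ × Ξ ∈ Θ ∷ Θs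
  dial-total V x Θ [] = Θ , end , here refl
  dial-total V x Θ (Θ′ ∷ Θs) with em (∃ λ y → Succ V x y)
  ... | yes (y , s) = let Ξ , d , m = dial-total V y Θ′ Θs in Ξ , step s d , there m
  ... | no none′ = Θ , stop (λ s → none′ (_ , s)) , here refl

  -- Each point is replaced by ω* + ω*, so that (v , false , j) has exactly j
  -- iterated immediate successors.
  blow-up : LinOrd → LinOrd
  blow-up V = toLinOrd (toOrder em V ⊗ Bool-order ⊗ ℕᵒᵖ)

  blow-up-↪ : ∀ {V} → ℕ → V ↪ blow-up V
  blow-up-↪ j = inc-↪ em (λ v → v , false , j) inj₁

  blow-up-succ : ∀ {V v} j → Succ (blow-up V) (v , false , suc j) (v , false , j)
  blow-up-succ {V} {v} j = succ (inj₁ p) (λ ()) λ z z≰ → Order.≮⇒≽ X (λ z<v → gap (Order.≮⇒≽ X (z≰ ∘ inj₁)) (λ { refl → z≰ (inj₂ refl) }) z<v)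
    where
    X = toOrder em V ⊗ Bool-order ⊗ ℕᵒᵖ
    p : (v , false , suc j) <[ X ] (v , false , j)
    p = inj₂ (refl , inj₂ (refl , ℕₚ.n<1+n j))
    gap : ∀ {z} → Order._≼_ X (v , false , suc j) z → z ≢ (v , false , suc j) → ¬ (z <[ X ] (v , false , j))
    gap (inj₂ refl) z≢ _ = z≢ refl
    gap (inj₁ (inj₁ q)) _ (inj₁ r) = Order.<-asym (toOrder em V) q r
    gap (inj₁ (inj₁ q)) _ (inj₂ (refl , _)) = Order.<-irrefl (toOrder em V) q
    gap (inj₁ (inj₂ (refl , _))) _ (inj₁ r) = Order.<-irrefl (toOrder em V) r
    gap (inj₁ (inj₂ (refl , inj₂ (refl , q)))) _ (inj₂ (_ , inj₂ (_ , r))) = ℕₚ.<⇒≱ q r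
    gap (inj₁ (inj₂ (refl , inj₁ Bool.f<t))) _ (inj₂ (_ , inj₂ (() , _)))
    gap (inj₁ (inj₂ (refl , inj₁ Bool.f<t))) _ (inj₂ (_ , inj₁ ()))

  -- Directly above this point lies the block `(v , true , _)`, a copy of ω* and so without a least
  -- element: below any candidate there is a smaller one.
  blow-up-stop : ∀ {V v y} → ¬ Succ (blow-up V) (v , false , 0) y
  blow-up-stop {V} {v} (succ p q r) = skip p q r
    where
    X = toOrder em V ⊗ Bool-order ⊗ ℕᵒᵖ
    ≰ : ∀ {x z} → z <[ X ] x → ¬ LinOrd._≤_ (blow-up V) x z
    ≰ q r = Order.<-irrefl X (Order.<-≼-trans X q r)
    skip : ∀ {y} → LinOrd._≤_ (blow-up V) (v , false , 0) y → ¬ ((v , false , 0) ≡ y) →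
      ¬ (∀ z → ¬ LinOrd._≤_ (blow-up V) z (v , false , 0) → LinOrd._≤_ (blow-up V) y z)
    skip (inj₂ eq) q r = q eq
    skip (inj₁ (inj₁ p)) q r =
      ≰ (inj₁ p) (r (v , true , 0) (≰ (inj₂ (refl , inj₁ Bool.f<t))))
    skip {_ , _ , n} (inj₁ (inj₂ (refl , inj₁ Bool.f<t))) q r =
      ≰ (inj₂ (refl , inj₂ (refl , ℕₚ.n<1+n n))) (r (v , true , suc n) (≰ (inj₂ (refl , inj₁ Bool.f<t))))
    skip (inj₁ (inj₂ (refl , inj₂ (refl , ())))) q r

  -- The number `j` is the position of `Ξ` in the list.
  dial-reach : ∀ {V} x {Θ Θs Ξ} → Ξ ∈ Θ ∷ Θs → ∃ λ j → Dial (blow-up V) (x , false , j) Θ Θs Ξ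
  dial-reach x {Θs = []}    (here refl) = 0 , end
  dial-reach x {Θs = _ ∷ _} (here refl) = 0 , stop blow-up-stop
  dial-reach x {Θs = _ ∷ _} (there m)   = let j , d = dial-reach x m in suc j , step (blow-up-succ j) d

  module _ {W : LinOrd} (w : Carrier W) (Θ : Valuation) (Θs : List Valuation) where

    dials : ℕ → Fm (Carrier W) 0
    dials i = dial Θ Θs i (con w)

    -- For a box, every extension shows some listed valuation (`dial-total`), and every listed
    -- valuation is shown by some extension (`dial-reach`).
    dial-truth : ∀ A {V} {κ : Carrier W → Carrier V} {ρ Ξ} → Dial V (κ w) Θ Θs Ξ →
      (Forces (Θ ∷ Θs) Ξ A → Sat V κ ρ (inst dials A)) × (Sat V κ ρ (inst dials A) → Forces (Θ ∷ Θs) Ξ A)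
    dial-truth (pv i) {V} {κ} {ρ} {Ξ} d with Ξ i | dial-sat {V = V} {κ = κ} {ρ = ρ} (con w) i d
    ... | true  | pos , _ = (λ _ → pos refl) , λ _ → refl
    ... | false | _ , neg = (λ ()) , λ h → contradiction h (neg refl)
    dial-truth ⊥ₚ d = (λ ()) , λ h → lower h
    dial-truth (A ⇒ₚ B) d =
      (λ f a → proj₁ (dial-truth B d) (f (proj₂ (dial-truth A d) a))) ,
      (λ h a → proj₂ (dial-truth B d) (h (proj₁ (dial-truth A d) a)))
    dial-truth (□ₚ A) {V} {κ} d =
      (λ f U g → let _ , e , m = dial-total U (fun g (κ w)) Θ Θs in proj₁ (dial-truth A e) (f m)) ,
      (λ h m → let j , e = dial-reach {V} (κ w) m in proj₂ (dial-truth A e) (h _ (blow-up-↪ j)))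

  Val⇒S5 : ∀ {W} → IsNonemptyDLOWithoutEndpoints W → ∀ ψ → Val W ψ → S5⊢ ψ
  Val⇒S5 {W} dlo ψ val with em (S5⊢ ψ)
  ... | yes d = d
  ... | no ⊬ψ with countermodel em ⊬ψ
  ...   | Θ , Θs , ⊮ψ = contradiction (proj₂ (dial-truth {W} w Θ Θs ψ {W} {id} {λ ()} (start Θs)) (val (dials {W} w Θ Θs))) ⊮ψ
    where
    open IsNonemptyDLOWithoutEndpoints dlo renaming (nonempty to w)
    -- By density `w` has no immediate successor, so in `W` the dial shows `Θ`, the valuation at
    -- which `ψ` fails.
    start : ∀ Θs → Dial W w Θ Θs Θ
    start []       = end
    start (_ ∷ _) = stop λ { (succ p q r) →
      let z , (w≤z , w≢z) , (z≤y , z≢y) = dense _ _ (p , q)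
          antisym = IsTotalOrder.antisym (LinOrd.isTotalOrder W)
      in z≢y (antisym z≤y (r z (λ z≤w → w≢z (antisym w≤z z≤w)))) }

-- Necessity of the order-theoretic conditions

module _ (em : ExcludedMiddle) {W : LinOrd} (B : Val W (◇ₚ (□ₚ (pv 0)) ⇒ₚ pv 0)) where
  private module W = LinOrd W

  -- The instance of ◇□p → p for p := ∃ x. ¬ θ.
  possible-witness : (θ : Fm (Carrier W) 1) {V : LinOrd} (f : W ↪ V) (a : Carrier V) →
    (∀ {U} (g : V ↪ U) ρ → ¬ Sat U (fun g ∘ fun f) (fun g a Vec.∷ ρ) θ) → ¬ Sat W id (λ ()) (∀' θ)
  possible-witness θ {V} f a h k = lower (B (λ _ → ¬' (∀' θ))
    (λ □¬□ → □¬□ V f (λ U g all → lift (h g _ (all (fun g a))))) k)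

  private
    X = toOrder em W ⊗ Bool-order ⊗ ℕᵒᵖ

    f : W ↪ blow-up em W
    f = blow-up-↪ em 0

    ≰ : ∀ {U x z} (g : blow-up em W ↪ U) → z <[ X ] x → ¬ LinOrd._≤_ U (fun g x) (fun g z)
    ≰ g z<x gx≤gz = Order.<-irrefl X (Order.<-≼-trans X z<x (_↪_.reflect g gx≤gz))

    just-above : ∀ {x} → (x , false , 0) <[ X ] (x , true , 0)
    just-above = inj₂ (refl , inj₁ Bool.f<t)

    ≮⇒≥ : ∀ {x y} → ¬ (x <[ toOrder em W ] y) → y W.≤ x
    ≮⇒≥ x≮y = ≼⇒≤ em W (Order.≮⇒≽ (toOrder em W) x≮y)

  B⇒DLO : IsNonemptyDLOWithoutEndpoints W
  B⇒DLO = record { nonempty = nonempty ; dense = dense ; noLeast = noLeast ; noGreatest = noGreatest }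
    where
    nonempty : Carrier W
    nonempty with em (Carrier W)
    ... | yes w = w
    -- With `⊥'` for `θ` the sentence says that a point exists; ℕᵒᵖ serves as a nonempty extension
    -- of the empty order.
    ... | no empty = ⊥-elim (possible-witness ⊥' {toLinOrd ℕᵒᵖ}
      (record { fun = ⊥-elim ∘ empty ; mono = λ {x} → ⊥-elim (empty x) ; reflect = λ {x} → ⊥-elim (empty x) })
      0 (λ _ _ → lower) (λ w → lift (empty w)))
    noLeast : ∀ x → ∃ λ y → y <[ toOrder em W ] x
    noLeast x with em (∃ λ y → y <[ toOrder em W ] x)
    ... | yes p = p
    -- `f` sends `x` to `(x , false , 0)`, and `(x , false , 1)` is a new point below it.
    ... | no none′ = ⊥-elim (possible-witness (con x ≤' var zero) f (x , false , 1)
      (λ g _ → ≰ g (inj₂ (refl , inj₂ (refl , ℕₚ.n<1+n 0))) ∘ lower)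
      (λ y → lift (≮⇒≥ (λ y<x → none′ (y , y<x)))))
    noGreatest : ∀ x → ∃ λ y → x <[ toOrder em W ] y
    noGreatest x with em (∃ λ y → x <[ toOrder em W ] y)
    ... | yes p = p
    ... | no none′ = ⊥-elim (possible-witness (var zero ≤' con x) f (x , true , 0)
      (λ g _ → ≰ g just-above ∘ lower)
      (λ y → lift (≮⇒≥ (λ x<y → none′ (y , x<y)))))
    dense : ∀ x y → x <[ toOrder em W ] y → ∃ λ z → x <[ toOrder em W ] z × z <[ toOrder em W ] y
    dense x y x<y with em (∃ λ z → x <[ toOrder em W ] z × z <[ toOrder em W ] y)
    ... | yes p = p
    -- The formula says that the point avoids the gap between `x` and `y`, and `(x , true , 0)` lies
    -- in that gap.
    ... | no none′ = ⊥-elim (possible-witness (¬' (var zero ≤' con x) ⇒ (con y ≤' var zero)) f (x , true , 0)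
      (λ g _ h → ≰ g (inj₁ x<y) (lower (h (λ p → lift (≰ g just-above (lower p))))))
      (λ z z≰x → lift (≮⇒≥ (λ z<y → lower (z≰x (lift (≮⇒≥ (λ x<z → none′ (z , x<z , z<y)))))))))

theorem6p13 : ((P : Set₁) → P ⊎ ¬ P) → (W : LinOrd) →
    ((ψ : PFm) → Val W ψ ⇔ (S5⊢ ψ)) ⇔ IsNonemptyDLOWithoutEndpoints W
theorem6p13 lem W = mk⇔
  (λ val → B⇒DLO em (Equivalence.from (val _) (axB (pv 0))))
  (λ dlo ψ → mk⇔ (Val⇒S5 em dlo ψ) (λ d σ → sound em dlo lem d σ id-↪ (λ ())))
  where
  em : ExcludedMiddle
  em P with lem (Lift _ P)
  ... | inj₁ (lift p) = yes p
  ... | inj₂ ¬p       = no (¬p ∘ lift)
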